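{- Let $m\ge2$. The limit $p_\bot(m):=\lim_{n\to\infty}g_n^{(0)}/g_n$ equals $$p_\bot(m)=\frac12\left(1-\sqrt{\frac{m}{m+4}}\right).$$ In particular $p_\bot(m)\sim\frac1m$ as $m\to\infty$.
   Context: For an integer $m\ge2$ let $V_m=\{v_0<v_1<\cdots<v_{m-1}\}$ ($v_0=0$, $v_{m-1}=1$) be an $m$-element chain with Gödel implication $v_p\Rightarrow_G v_q=v_{m-1}$ if $p\le q$ and $v_p\Rightarrow_G v_q=v_q$ if $p>q$. For $n\ge1$, consider the $C_{n-1}$ full bracketings of $p_1\Rightarrow_G\cdots\Rightarrow_G p_n$ in $n$ distinct variables (full binary trees with $n$ ordered leaves), $C_k$ being the Catalan numbers. Let $g_n^{(j)}$ be the number of pairs (bracketing, valuation $\{p_1,\dots,p_n\}\to V_m$) for which the bracketed formula evaluates to $v_j$, and $g_n=\sum_{j=0}^{m-1}g_n^{(j)}=m^nC_{n-1}$. -}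

module Defs where

open import Data.Nat.Base as ℕ using (ℕ; zero; suc)
import Data.Nat.Properties as ℕ
import Data.Nat.DivMod as ℕ
open import Data.Nat.ListAction using (sum)
import Data.Nat.Tactic.RingSolver as ℕSolver
open import Data.Integer.Base as ℤ using (+_)
import Data.Integer.Properties as ℤ
open import Data.Rational.Base hiding (_≃_)
open import Data.Rational.Properties
open import Data.Rational.Solver using (module +-*-Solver)
import Data.Rational.Unnormalised.Base as ℚᵘ
import Data.Rational.Unnormalised.Properties as ℚᵘ
open import Data.Fin.Base using (Fin; toℕ; fromℕ)
open import Data.List.Base using (List; []; _∷_; map; length; filter; concatMap;
  cartesianProductWith; allFin; upTo)
open import Data.List.Membership.Propositional using (_∈_)
open import Data.List.Membership.Propositional.Properties
open import Data.List.Relation.Binary.Disjoint.Propositional using (Disjoint)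
open import Data.List.Relation.Unary.All as All using (All; []; _∷_)
import Data.List.Relation.Unary.All.Properties as All
open import Data.List.Relation.Unary.AllPairs as AllPairs using (AllPairs; []; _∷_)
import Data.List.Relation.Unary.AllPairs.Properties as AllPairs
open import Data.List.Relation.Unary.Any using (here; there)
open import Data.List.Relation.Unary.Unique.Propositional using (Unique)
import Data.List.Relation.Unary.Unique.Propositional.Properties as Unique
open import Data.Product.Base using (Σ; ∃; _×_; _,_; proj₁; proj₂)
open import Data.Sum.Base using (inj₁; inj₂)
open import Data.Vec.Base using (Vec; []; _∷_; take; drop)
import Data.Vec.Properties as Vec
open import Relation.Binary.PropositionalEquality
open import Relation.Nullary using (yes; no; contradiction)

-- The chain V_m is Fin m with its usual order, so v_j is the element
-- with toℕ equal to j, and the top of Fin (suc k) is fromℕ k.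

infixr 5 _⇒ᴳ_
_⇒ᴳ_ : ∀ {m} → Fin m → Fin m → Fin m
_⇒ᴳ_ {suc k} p q with toℕ p ℕ.≤? toℕ q
... | yes _ = fromℕ k
... | no  _ = q

infixr 5 _⇒_
data Bracketing : Set where
  leaf : Bracketing
  _⇒_  : Bracketing → Bracketing → Bracketing

leaves : Bracketing → ℕ
leaves leaf    = 1
leaves (s ⇒ t) = leaves s ℕ.+ leaves t

-- The i-th entry of the vector is the value of the variable at the
-- i-th leaf from the left.
eval : ∀ {m} (t : Bracketing) → Vec (Fin m) (leaves t) → Fin m
eval leaf    (x ∷ []) = x
eval (s ⇒ t) v        = eval s (take (leaves s) v) ⇒ᴳ eval t (drop (leaves s) v)

-- Bracketings with n leaves and depth less than d.
bracketings< : (d n : ℕ) → List Bracketing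
bracketings< zero    n             = []
bracketings< (suc d) 0             = []
bracketings< (suc d) 1             = leaf ∷ []
bracketings< (suc d) (suc (suc k)) =
  concatMap (λ i → cartesianProductWith _⇒_ (bracketings< d (suc i))
                                            (bracketings< d (suc k ℕ.∸ i)))
            (upTo (suc k))

-- A bracketing with n leaves has depth at most n - 1.
bracketings : ℕ → List Bracketing
bracketings n = bracketings< n n

valuations : (m n : ℕ) → List (Vec (Fin m) n)
valuations m zero    = [] ∷ []
valuations m (suc n) = cartesianProductWith _∷_ (allFin m) (valuations m n)

ValuedBracketing : ℕ → Set
ValuedBracketing m = Σ Bracketing λ t → Vec (Fin m) (leaves t)

valuedBracketings : (m n : ℕ) → List (ValuedBracketing m)
valuedBracketings m n =
  concatMap (λ t → map (t ,_) (valuations m (leaves t))) (bracketings n)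

-- g m n j is g_n^{(j)} for the m-element chain.
g : (m n j : ℕ) → ℕ
g m n j = length (filter (λ (t , v) → toℕ (eval t v) ℕ.≟ j) (valuedBracketings m n))

gTotal : (m n : ℕ) → ℕ
gTotal m n = sum (map (g m n) (upTo m))

-- Division by zero gives zero; it only affects finitely many terms of
-- the sequences below (gTotal m n vanishes only if n = 0 or m = 0).
infixl 7 _÷ℕ_
_÷ℕ_ : ℕ → ℕ → ℚ
a ÷ℕ zero  = 0ℚ
a ÷ℕ suc b = + a / suc b

private
  leaves>0 : ∀ t → 1 ℕ.≤ leaves t
  leaves>0 leaf    = ℕ.≤-refl
  leaves>0 (s ⇒ t) = ℕ.≤-trans (leaves>0 s) (ℕ.m≤m+n _ _)

  ⇒-injective : ∀ {s t s′ t′} → s ⇒ t ≡ s′ ⇒ t′ → s ≡ s′ × t ≡ t′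
  ⇒-injective refl = refl , refl

  ∈-concatMap⁻′ : ∀ {A B : Set} (f : A → List B) xs {b} →
                  b ∈ concatMap f xs → ∃ λ x → x ∈ xs × b ∈ f x
  ∈-concatMap⁻′ f xs b∈ with ∈-concat⁻′ (map f xs) b∈
  ... | _ , b∈′ , l∈ with ∈-map⁻ f l∈
  ... | x , x∈ , refl = x , x∈ , b∈′

  concatMap-unique : ∀ {A B : Set} (f : A → List B) {xs} →
    (∀ {x y b} → b ∈ f x → b ∈ f y → x ∈ xs → y ∈ xs → x ≡ y) →
    (∀ x → Unique (f x)) → Unique xs → Unique (concatMap f xs)
  concatMap-unique {A} {B} f {xs} inj uf u = Unique.concat⁺
    (All.map⁺ (All.universal uf xs)) (AllPairs.map⁺ (disjoint xs inj u))
    where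
    disjoint : ∀ xs → (∀ {x y b} → b ∈ f x → b ∈ f y → x ∈ xs → y ∈ xs → x ≡ y) →
               Unique xs → AllPairs (λ x y → Disjoint (f x) (f y)) xs
    disjoint []       inj []      = []
    disjoint (x ∷ xs) inj (p ∷ u) =
      All.tabulate (λ y∈ (b∈x , b∈y) →
        All.lookup p y∈ (inj b∈x b∈y (here refl) (there y∈)))
      ∷ disjoint xs (λ b∈x b∈y x∈ y∈ → inj b∈x b∈y (there x∈) (there y∈)) u

  ∈-bracketings<⁻ : ∀ d n {t} → t ∈ bracketings< d n → leaves t ≡ n
  ∈-bracketings<⁻ (suc d) 1             (here refl) = refl
  ∈-bracketings<⁻ (suc d) (suc (suc k)) t∈
    with ∈-concatMap⁻′ (λ i → cartesianProductWith _⇒_ (bracketings< d (suc i))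
                                (bracketings< d (suc k ℕ.∸ i))) (upTo (suc k)) t∈
  ... | i , i∈ , t∈′ with ∈-cartesianProductWith⁻ _⇒_
    (bracketings< d (suc i)) (bracketings< d (suc k ℕ.∸ i)) t∈′
  ... | _ , _ , s∈ , u∈ , refl = trans
    (cong₂ ℕ._+_ (∈-bracketings<⁻ d _ s∈) (∈-bracketings<⁻ d _ u∈))
    (cong suc (ℕ.m+[n∸m]≡n (ℕ.<⇒≤ (∈-upTo⁻ i∈))))

  ∈-bracketings<⁺ : ∀ d n t → leaves t ≡ n → n ℕ.≤ d → t ∈ bracketings< d n
  ∈-bracketings<⁺ zero    _ t       refl le =
    contradiction (ℕ.≤-trans (leaves>0 t) le) λ ()
  ∈-bracketings<⁺ (suc d) _ leaf    refl le = here refl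
  ∈-bracketings<⁺ (suc d) n (s ⇒ t) eq   le
    with leaves s in eqs | leaves t in eqt | leaves>0 s | leaves>0 t
  ... | suc i | suc j | _ | _ with n
  ... | zero = contradiction eq λ ()
  ... | suc zero = contradiction (trans (sym (ℕ.+-suc i j)) (ℕ.suc-injective eq)) λ ()
  ... | suc (suc k) =
    ∈-concat⁺′
      (∈-cartesianProductWith⁺ _⇒_
        (∈-bracketings<⁺ d (suc i) s eqs (ℕ.≤-trans i<k (ℕ.s≤s⁻¹ le)))
        (∈-bracketings<⁺ d (suc k ℕ.∸ i) t (trans eqt (sym diff))
          (ℕ.≤-trans (ℕ.m∸n≤m (suc k) i) (ℕ.s≤s⁻¹ le))))
      (∈-map⁺ _ (∈-upTo⁺ i<k))
    where
    eq′ : i ℕ.+ suc j ≡ suc k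
    eq′ = ℕ.suc-injective eq
    i<k : i ℕ.< suc k
    i<k = subst (i ℕ.<_) eq′ (ℕ.m<m+n i (ℕ.s≤s ℕ.z≤n))
    diff : suc k ℕ.∸ i ≡ suc j
    diff = trans (cong (ℕ._∸ i) (sym eq′)) (ℕ.m+n∸m≡n i (suc j))

  bracketings<-unique : ∀ d n → Unique (bracketings< d n)
  bracketings<-unique zero    n             = []
  bracketings<-unique (suc d) 0             = []
  bracketings<-unique (suc d) 1             = [] ∷ []
  bracketings<-unique (suc d) (suc (suc k)) = concatMap-unique _ inj
    (λ i → Unique.cartesianProductWith⁺ _⇒_ ⇒-injective
             (bracketings<-unique d _) (bracketings<-unique d _))
    (Unique.upTo⁺ (suc k))
    where
    inj : ∀ {x y b} →
      b ∈ cartesianProductWith _⇒_ (bracketings< d (suc x)) (bracketings< d (suc k ℕ.∸ x)) →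
      b ∈ cartesianProductWith _⇒_ (bracketings< d (suc y)) (bracketings< d (suc k ℕ.∸ y)) →
      x ∈ upTo (suc k) → y ∈ upTo (suc k) → x ≡ y
    inj {x} {y} b∈x b∈y _ _
      with ∈-cartesianProductWith⁻ _⇒_
             (bracketings< d (suc x)) (bracketings< d (suc k ℕ.∸ x)) b∈x
         | ∈-cartesianProductWith⁻ _⇒_
             (bracketings< d (suc y)) (bracketings< d (suc k ℕ.∸ y)) b∈y
    ... | _ , _ , s∈ , _ , refl | _ , _ , s∈′ , _ , refl =
      ℕ.suc-injective (trans (sym (∈-bracketings<⁻ d _ s∈)) (∈-bracketings<⁻ d _ s∈′))

∈-bracketings⁺ : ∀ t → t ∈ bracketings (leaves t)
∈-bracketings⁺ t = ∈-bracketings<⁺ _ _ t refl ℕ.≤-refl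

∈-bracketings⁻ : ∀ {n t} → t ∈ bracketings n → leaves t ≡ n
∈-bracketings⁻ {n} = ∈-bracketings<⁻ n n

bracketings-unique : ∀ n → Unique (bracketings n)
bracketings-unique n = bracketings<-unique n n

∈-valuations : ∀ {m n} (v : Vec (Fin m) n) → v ∈ valuations m n
∈-valuations []      = here refl
∈-valuations (x ∷ v) = ∈-cartesianProductWith⁺ _∷_ (∈-allFin x) (∈-valuations v)

valuations-unique : ∀ m n → Unique (valuations m n)
valuations-unique m zero    = [] ∷ []
valuations-unique m (suc n) = Unique.cartesianProductWith⁺ _∷_ Vec.∷-injective
  (Unique.allFin⁺ m) (valuations-unique m n)

∈-valuedBracketings⁺ : ∀ {m} (tv : ValuedBracketing m) →
                       tv ∈ valuedBracketings m (leaves (proj₁ tv))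
∈-valuedBracketings⁺ (t , v) = ∈-concat⁺′ (∈-map⁺ (t ,_) (∈-valuations v))
  (∈-map⁺ _ (∈-bracketings⁺ t))

∈-valuedBracketings⁻ : ∀ {m n} {tv : ValuedBracketing m} →
                       tv ∈ valuedBracketings m n → leaves (proj₁ tv) ≡ n
∈-valuedBracketings⁻ {m} {n} tv∈
  with ∈-concatMap⁻′ (λ t → map (t ,_) (valuations m (leaves t))) (bracketings n) tv∈
... | t , t∈ , tv∈′ with ∈-map⁻ (t ,_) tv∈′
... | _ , _ , refl = ∈-bracketings⁻ t∈

valuedBracketings-unique : ∀ m n → Unique (valuedBracketings m n)
valuedBracketings-unique m n = concatMap-unique _ inj
  (λ t → Unique.map⁺ (λ { refl → refl }) (valuations-unique m (leaves t)))
  (bracketings-unique n)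
  where
  inj : ∀ {s t} {b : ValuedBracketing m} →
    b ∈ map (s ,_) (valuations m (leaves s)) → b ∈ map (t ,_) (valuations m (leaves t)) →
    s ∈ bracketings n → t ∈ bracketings n → s ≡ t
  inj {s} {t} b∈s b∈t _ _ with ∈-map⁻ (s ,_) b∈s | ∈-map⁻ (t ,_) b∈t
  ... | _ , _ , refl | _ , _ , refl = refl

private
  ½-pos : ∀ {ε} → 0ℚ < ε → 0ℚ < ½ * ε
  ½-pos {ε} 0<ε = subst (_< ½ * ε) (*-zeroʳ ½) (*-monoʳ-<-pos ½ 0<ε)

  ½+½ : ∀ ε → ½ * ε + ½ * ε ≡ ε
  ½+½ ε = trans (sym (*-distribʳ-+ ε ½ ½)) (*-identityˡ ε)

  <-sum : ∀ {a b} ε → a < ½ * ε → b < ½ * ε → a + b < ε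
  <-sum ε p q = subst (_ <_) (½+½ ε) (+-mono-< p q)

  *-pos : ∀ {a b} → 0ℚ < a → 0ℚ < b → 0ℚ < a * b
  *-pos {a} {b} 0<a 0<b =
    positive⁻¹ (a * b) {{pos*pos⇒pos a {{positive 0<a}} b {{positive 0<b}}}}

  *-mono-≤ : ∀ {a b c d} → 0ℚ ≤ a → 0ℚ ≤ d → a ≤ b → c ≤ d → a * c ≤ b * d
  *-mono-≤ {a} {b} {c} {d} 0≤a 0≤d a≤b c≤d = ≤-trans
    (*-monoˡ-≤-nonNeg a {{nonNegative 0≤a}} c≤d)
    (*-monoʳ-≤-nonNeg d {{nonNegative 0≤d}} a≤b)

  p≤∣p∣ : ∀ p → p ≤ ∣ p ∣
  p≤∣p∣ p with ≤-total 0ℚ p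
  ... | inj₁ 0≤p = ≤-reflexive (sym (0≤p⇒∣p∣≡p 0≤p))
  ... | inj₂ p≤0 = ≤-trans p≤0 (0≤∣p∣ p)

  ∣p∣<q : ∀ {p q} → p < q → - p < q → ∣ p ∣ < q
  ∣p∣<q {p} p<q -p<q with ∣p∣≡p∨∣p∣≡-p p
  ... | inj₁ eq = subst (_< _) (sym eq) p<q
  ... | inj₂ eq = subst (_< _) (sym eq) -p<q

  ∣p∣≤∣q∣+∣p-q∣ : ∀ p q → ∣ p ∣ ≤ ∣ q ∣ + ∣ p - q ∣
  ∣p∣≤∣q∣+∣p-q∣ p q = subst (λ r → ∣ r ∣ ≤ ∣ q ∣ + ∣ p - q ∣)
    (solve 2 (λ p q → q :+ (p :- q) := p) refl p q) (∣p+q∣≤∣p∣+∣q∣ q (p - q))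
    where open +-*-Solver

  p<q+r⇒p-q<r : ∀ {p q r} → p < q + r → p - q < r
  p<q+r⇒p-q<r {p} {q} {r} lt = subst (p - q <_)
    (solve 2 (λ q r → (q :+ r) :- q := r) refl q r) (+-monoˡ-< (- q) lt)
    where open +-*-Solver

  p-q-swap : ∀ p q → - (p - q) ≡ q - p
  p-q-swap = solve 2 (λ p q → :- (p :- q) := q :- p) refl
    where open +-*-Solver

  ∣p-q∣-sym : ∀ p q → ∣ p - q ∣ ≡ ∣ q - p ∣
  ∣p-q∣-sym p q = trans (sym (∣-p∣≡∣p∣ (p - q))) (cong ∣_∣ (p-q-swap p q))

  ∣∣p∣-∣q∣∣≤∣p-q∣ : ∀ p q → ∣ ∣ p ∣ - ∣ q ∣ ∣ ≤ ∣ p - q ∣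
  ∣∣p∣-∣q∣∣≤∣p-q∣ p q with ∣p∣≡p∨∣p∣≡-p (∣ p ∣ - ∣ q ∣)
  ... | inj₁ eq = subst (_≤ ∣ p - q ∣) (sym eq) (lem p q)
    where
    open +-*-Solver
    lem : ∀ p q → ∣ p ∣ - ∣ q ∣ ≤ ∣ p - q ∣
    lem p q = subst (∣ p ∣ - ∣ q ∣ ≤_)
      (solve 2 (λ a b → (a :+ b) :- a := b) refl ∣ q ∣ ∣ p - q ∣)
      (+-monoˡ-≤ (- ∣ q ∣) (∣p∣≤∣q∣+∣p-q∣ p q))
  ... | inj₂ eq = subst (_≤ ∣ p - q ∣) (sym (trans eq (p-q-swap ∣ p ∣ ∣ q ∣)))
    (subst (∣ q ∣ - ∣ p ∣ ≤_) (trans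
      (solve 2 (λ a b → (a :+ b) :- a := b) refl ∣ p ∣ ∣ q - p ∣) (∣p-q∣-sym q p))
      (+-monoˡ-≤ (- ∣ p ∣) (∣p∣≤∣q∣+∣p-q∣ q p)))
    where open +-*-Solver

  toℚᵘ-/ : ∀ a b → ℚᵘ._≃_ (toℚᵘ (+ a / suc b)) (ℚᵘ.mkℚᵘ (+ a) b)
  toℚᵘ-/ a b = toℚᵘ-fromℚᵘ (ℚᵘ.mkℚᵘ (+ a) b)

  /-nonNeg : ∀ a b → 0ℚ ≤ + a / suc b
  /-nonNeg a b = nonNegative⁻¹ (+ a / suc b) {{normalize-nonNeg a (suc b)}}

  /-mono-≤ : ∀ {a b c d} → a ℕ.* suc d ℕ.≤ c ℕ.* suc b → + a / suc b ≤ + c / suc d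
  /-mono-≤ {a} {b} {c} {d} le = toℚᵘ-cancel-≤ (begin
    toℚᵘ (+ a / suc b) ≃⟨ toℚᵘ-/ a b ⟩
    ℚᵘ.mkℚᵘ (+ a) b    ≤⟨ ℚᵘ.*≤* (subst₂ ℤ._≤_ (ℤ.pos-* a (suc d)) (ℤ.pos-* c (suc b))
                                    (ℤ.+≤+ le)) ⟩
    ℚᵘ.mkℚᵘ (+ c) d    ≃⟨ ℚᵘ.≃-sym (toℚᵘ-/ c d) ⟩
    toℚᵘ (+ c / suc d) ∎)
    where open ℚᵘ.≤-Reasoning

  /-mono-< : ∀ {a b c d} → a ℕ.* suc d ℕ.< c ℕ.* suc b → + a / suc b < + c / suc d
  /-mono-< {a} {b} {c} {d} lt = toℚᵘ-cancel-< (begin-strict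
    toℚᵘ (+ a / suc b) ≃⟨ toℚᵘ-/ a b ⟩
    ℚᵘ.mkℚᵘ (+ a) b    <⟨ ℚᵘ.*<* (subst₂ ℤ._<_ (ℤ.pos-* a (suc d)) (ℤ.pos-* c (suc b))
                                    (ℤ.+<+ lt)) ⟩
    ℚᵘ.mkℚᵘ (+ c) d    ≃⟨ ℚᵘ.≃-sym (toℚᵘ-/ c d) ⟩
    toℚᵘ (+ c / suc d) ∎)
    where open ℚᵘ.≤-Reasoning

  /-*-/ : ∀ a b c d → (+ a / suc b) * (+ c / suc d) ≡ + (a ℕ.* c) / (suc b ℕ.* suc d)
  /-*-/ a b c d = toℚᵘ-injective (begin
    toℚᵘ ((+ a / suc b) * (+ c / suc d))           ≈⟨ toℚᵘ-homo-* (+ a / suc b) (+ c / suc d) ⟩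
    toℚᵘ (+ a / suc b) ℚᵘ.* toℚᵘ (+ c / suc d)     ≈⟨ ℚᵘ.*-cong (toℚᵘ-/ a b) (toℚᵘ-/ c d) ⟩
    ℚᵘ.mkℚᵘ (+ a) b ℚᵘ.* ℚᵘ.mkℚᵘ (+ c) d           ≡⟨ cong (λ z → ℚᵘ.mkℚᵘ z _) (sym (ℤ.pos-* a c)) ⟩
    ℚᵘ.mkℚᵘ (+ (a ℕ.* c)) _                        ≈⟨ ℚᵘ.≃-sym (toℚᵘ-/ (a ℕ.* c) _) ⟩
    toℚᵘ (+ (a ℕ.* c) / (suc b ℕ.* suc d))         ∎)
    where open ℚᵘ.≃-Reasoning

  /-suc : ∀ a n → + suc a / suc n ≡ + a / suc n + + 1 / suc n
  /-suc a n = toℚᵘ-injective (begin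
    toℚᵘ (+ suc a / suc n)                         ≈⟨ toℚᵘ-/ (suc a) n ⟩
    ℚᵘ.mkℚᵘ (+ suc a) n                            ≈⟨ ℚᵘ.*≡* lem ⟩
    ℚᵘ.mkℚᵘ (+ a) n ℚᵘ.+ ℚᵘ.mkℚᵘ (+ 1) n           ≈⟨ ℚᵘ.≃-sym (ℚᵘ.+-cong (toℚᵘ-/ a n) (toℚᵘ-/ 1 n)) ⟩
    toℚᵘ (+ a / suc n) ℚᵘ.+ toℚᵘ (+ 1 / suc n)     ≈⟨ ℚᵘ.≃-sym (toℚᵘ-homo-+ (+ a / suc n) (+ 1 / suc n)) ⟩
    toℚᵘ (+ a / suc n + + 1 / suc n)               ∎)
    where
    open ℚᵘ.≃-Reasoning
    N = suc n
    nat : ∀ a N → (1 ℕ.+ a) ℕ.* (N ℕ.* N) ≡ (a ℕ.* N ℕ.+ 1 ℕ.* N) ℕ.* N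
    nat = ℕSolver.solve-∀
    lem : (+ suc a) ℤ.* (+ (N ℕ.* N)) ≡ ((+ a) ℤ.* + N ℤ.+ + 1 ℤ.* + N) ℤ.* + N
    lem = trans (sym (ℤ.pos-* (suc a) (N ℕ.* N))) (trans (cong +_ (nat a N))
      (trans (ℤ.pos-* (a ℕ.* N ℕ.+ 1 ℕ.* N) N) (cong (ℤ._* + N)
        (cong₂ ℤ._+_ (ℤ.pos-* a N) (ℤ.pos-* 1 N)))))

  ∣q∣≡/ : ∀ q → ∣ q ∣ ≡ + ℤ.∣ ↥ q ∣ / ↧ₙ q
  ∣q∣≡/ (mkℚ n d c) = sym (↥p/↧p≡p ∣ mkℚ n d c ∣)

  archimedean : ∀ {ε} → 0ℚ < ε → ∃ λ N → ∀ n → N ℕ.≤ n → + 1 / suc n ≤ ε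
  archimedean {mkℚ (+ zero) d c} (*<* (ℤ.+<+ ()))
  archimedean {ε@(mkℚ (+ suc a) d c)} _ = d , λ n d≤n →
    subst (+ 1 / suc n ≤_) (↥p/↧p≡p ε) (/-mono-≤ {1} {n} {suc a} {d}
      (ℕ.≤-trans (ℕ.≤-reflexive (ℕ.*-identityˡ (suc d)))
        (ℕ.≤-trans (ℕ.s≤s d≤n) (ℕ.m≤m+n (suc n) _))))
  archimedean {mkℚ ℤ.-[1+ n ] d c} (*<* ())

  divide : ∀ {ε C} → 0ℚ < ε → 0ℚ < C → ∃ λ δ → 0ℚ < δ × C * δ ≡ ε
  divide {ε} {C} 0<ε 0<C = 1/C * ε
    , *-pos (positive⁻¹ 1/C {{1/pos⇒pos C {{positive 0<C}}}}) 0<ε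
    , trans (sym (*-assoc C 1/C ε))
        (trans (cong (_* ε) (*-inverseʳ C {{>-nonZero 0<C}})) (*-identityˡ ε))
    where
    1/C : ℚ
    1/C = (1/ C) {{>-nonZero 0<C}}

  ∣*∣-bound : ∀ u v {D δ} → 0ℚ < D → ∣ u ∣ < D → ∣ v ∣ < δ → ∣ u * v ∣ < D * δ
  ∣*∣-bound u v {D} {δ} 0<D u<D v<δ = ≤-<-trans
    (≤-trans (≤-reflexive (∣p*q∣≡∣p∣*∣q∣ u v))
      (*-monoʳ-≤-nonNeg ∣ v ∣ {{∣-∣-nonNeg v}} (<⇒≤ u<D)))
    (*-monoʳ-<-pos D {{positive 0<D}} v<δ)

  *-close : ∀ {a b c d B C δ} → 0ℚ < B → 0ℚ < C → ∣ a ∣ < B → ∣ d ∣ < C →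
            ∣ a - c ∣ < δ → ∣ b - d ∣ < δ → ∣ a * b - c * d ∣ < (B + C) * δ
  *-close {a} {b} {c} {d} {B} {C} {δ} 0<B 0<C a<B d<C a-c<δ b-d<δ = begin-strict
    ∣ a * b - c * d ∣                        ≡⟨ cong ∣_∣ (lem a b c d) ⟩
    ∣ a * (b - d) + d * (a - c) ∣            ≤⟨ ∣p+q∣≤∣p∣+∣q∣ (a * (b - d)) (d * (a - c)) ⟩
    ∣ a * (b - d) ∣ + ∣ d * (a - c) ∣        <⟨ +-mono-< (∣*∣-bound a (b - d) 0<B a<B b-d<δ)
                                                         (∣*∣-bound d (a - c) 0<C d<C a-c<δ) ⟩
    B * δ + C * δ                            ≡⟨ *-distribʳ-+ δ B C ⟨
    (B + C) * δ                              ∎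
    where
    open ≤-Reasoning
    open +-*-Solver using (solve; _:+_; _:*_; _:-_; _:=_)
    lem : ∀ a b c d → a * b - c * d ≡ a * (b - d) + d * (a - c)
    lem = solve 4 (λ a b c d → a :* b :- c :* d := a :* (b :- d) :+ d :* (a :- c)) refl

-- Cauchy sequences of rationals, compared by _≃ℝ_.
record ℝ : Set where
  constructor mkℝ
  field
    seq    : ℕ → ℚ
    cauchy : ∀ ε → 0ℚ < ε →
             ∃ λ N → ∀ i j → N ℕ.≤ i → N ℕ.≤ j → ∣ seq i - seq j ∣ < ε

open ℝ public

infix 4 _≃ℝ_ _<ℝ_ _≤ℝ_

_≃ℝ_ : ℝ → ℝ → Set
x ≃ℝ y = ∀ ε → 0ℚ < ε → ∃ λ N → ∀ n → N ℕ.≤ n → ∣ seq x n - seq y n ∣ < ε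

_<ℝ_ : ℝ → ℝ → Set
x <ℝ y = ∃ λ ε → 0ℚ < ε × ∃ λ N → ∀ n → N ℕ.≤ n → seq x n + ε ≤ seq y n

_≤ℝ_ : ℝ → ℝ → Set
x ≤ℝ y = ∀ ε → 0ℚ < ε → ∃ λ N → ∀ n → N ℕ.≤ n → seq x n ≤ seq y n + ε

fromℚ : ℚ → ℝ
fromℚ q .seq _ = q
fromℚ q .cauchy ε 0<ε = 0 , λ _ _ _ _ →
  subst (λ r → ∣ r ∣ < ε) (sym (+-inverseʳ q)) 0<ε

0ℝ 1ℝ : ℝ
0ℝ = fromℚ 0ℚ
1ℝ = fromℚ 1ℚ

infixl 6 _+ℝ_ _-ℝ_
infixl 7 _*ℝ_

_+ℝ_ : ℝ → ℝ → ℝ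
(x +ℝ y) .seq n = seq x n + seq y n
(x +ℝ y) .cauchy ε 0<ε =
  let M , p = cauchy x (½ * ε) (½-pos 0<ε)
      N , q = cauchy y (½ * ε) (½-pos 0<ε)
  in M ℕ.⊔ N , λ i j hi hj →
     subst (λ r → ∣ r ∣ < ε) (lem (seq x i) (seq y i) (seq x j) (seq y j))
       (≤-<-trans (∣p+q∣≤∣p∣+∣q∣ (seq x i - seq x j) (seq y i - seq y j))
         (<-sum ε (p i j (ℕ.m⊔n≤o⇒m≤o M N hi) (ℕ.m⊔n≤o⇒m≤o M N hj))
                  (q i j (ℕ.m⊔n≤o⇒n≤o M N hi) (ℕ.m⊔n≤o⇒n≤o M N hj))))
  where
  open +-*-Solver
  lem : ∀ a b c d → (a - c) + (b - d) ≡ (a + b) - (c + d)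
  lem = solve 4 (λ a b c d → (a :- c) :+ (b :- d) := (a :+ b) :- (c :+ d)) refl

-ℝ_ : ℝ → ℝ
(-ℝ x) .seq n = - seq x n
(-ℝ x) .cauchy ε 0<ε =
  let N , p = cauchy x ε 0<ε
  in N , λ i j hi hj → subst (_< ε)
       (trans (sym (∣-p∣≡∣p∣ (seq x i - seq x j)))
              (cong ∣_∣ (neg-distrib-+ (seq x i) (- seq x j)))) (p i j hi hj)

_-ℝ_ : ℝ → ℝ → ℝ
x -ℝ y = x +ℝ (-ℝ y)

∣_∣ℝ : ℝ → ℝ
∣ x ∣ℝ .seq n = ∣ seq x n ∣
∣ x ∣ℝ .cauchy ε 0<ε =
  let N , p = cauchy x ε 0<ε
  in N , λ i j hi hj →
       ≤-<-trans (∣∣p∣-∣q∣∣≤∣p-q∣ (seq x i) (seq x j)) (p i j hi hj)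

private
  bounded : ∀ x → ∃ λ B → 0ℚ < B × ∃ λ N → ∀ n → N ℕ.≤ n → ∣ seq x n ∣ < B
  bounded x =
    let N , p = cauchy x 1ℚ (positive⁻¹ 1ℚ)
    in ∣ seq x N ∣ + 1ℚ
     , ≤-<-trans (0≤∣p∣ (seq x N)) (subst (_< ∣ seq x N ∣ + 1ℚ) (+-identityʳ ∣ seq x N ∣)
         (+-monoʳ-< ∣ seq x N ∣ (positive⁻¹ 1ℚ)))
     , N , λ n N≤n → ≤-<-trans (∣p∣≤∣q∣+∣p-q∣ (seq x n) (seq x N))
         (+-monoʳ-< ∣ seq x N ∣ (p n N N≤n ℕ.≤-refl))

_*ℝ_ : ℝ → ℝ → ℝ
(x *ℝ y) .seq n = seq x n * seq y n
(x *ℝ y) .cauchy ε 0<ε =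
  let B , 0<B , N₁ , b = bounded x
      C , 0<C , N₂ , c = bounded y
      δ , 0<δ , eq = divide 0<ε (+-mono-< 0<B 0<C)
      N₃ , p = cauchy x δ 0<δ
      N₄ , q = cauchy y δ 0<δ
      N₁₂ = N₁ ℕ.⊔ N₂
      N₃₄ = N₃ ℕ.⊔ N₄
  in N₁₂ ℕ.⊔ N₃₄ , λ i j hi hj →
     let hi₁₂ = ℕ.m⊔n≤o⇒m≤o N₁₂ N₃₄ hi
         hj₁₂ = ℕ.m⊔n≤o⇒m≤o N₁₂ N₃₄ hj
         hi₃₄ = ℕ.m⊔n≤o⇒n≤o N₁₂ N₃₄ hi
         hj₃₄ = ℕ.m⊔n≤o⇒n≤o N₁₂ N₃₄ hj
     in subst (∣ seq x i * seq y i - seq x j * seq y j ∣ <_) eq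
          (*-close 0<B 0<C
            (b i (ℕ.m⊔n≤o⇒m≤o N₁ N₂ hi₁₂)) (c j (ℕ.m⊔n≤o⇒n≤o N₁ N₂ hj₁₂))
            (p i j (ℕ.m⊔n≤o⇒m≤o N₃ N₄ hi₃₄) (ℕ.m⊔n≤o⇒m≤o N₃ N₄ hj₃₄))
            (q i j (ℕ.m⊔n≤o⇒n≤o N₃ N₄ hi₃₄) (ℕ.m⊔n≤o⇒n≤o N₃ N₄ hj₃₄)))

isqrt : ℕ → ℕ
isqrt zero    = 0
isqrt (suc n) with isqrt n
... | r with suc r ℕ.* suc r ℕ.≤? suc n
...   | yes _ = suc r
...   | no  _ = r

-- √-approx q n is the largest multiple of 1 / (n + 1) whose square is
-- at most ∣ q ∣.
√-numerator : ℚ → ℕ → ℕ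
√-numerator q n = isqrt (ℤ.∣ ↥ q ∣ ℕ.* (suc n ℕ.* suc n) ℕ./ ↧ₙ q)

√-approx : ℚ → ℕ → ℚ
√-approx q n = + √-numerator q n / suc n

private
  isqrt-lower : ∀ n → isqrt n ℕ.* isqrt n ℕ.≤ n
  isqrt-lower zero    = ℕ.z≤n
  isqrt-lower (suc n) with isqrt n | isqrt-lower n
  ... | r | r²≤n with suc r ℕ.* suc r ℕ.≤? suc n
  ...   | yes le = le
  ...   | no  _  = ℕ.m≤n⇒m≤1+n r²≤n

  isqrt-upper : ∀ n → n ℕ.< suc (isqrt n) ℕ.* suc (isqrt n)
  isqrt-upper zero    = ℕ.s≤s ℕ.z≤n
  isqrt-upper (suc n) with isqrt n | isqrt-upper n
  ... | r | n<[1+r]² with suc r ℕ.* suc r ℕ.≤? suc n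
  ...   | yes _ = ℕ.≤-<-trans n<[1+r]² (ℕ.*-mono-< (ℕ.n<1+n (suc r)) (ℕ.n<1+n (suc r)))
  ...   | no  ≰ = ℕ.≰⇒> ≰

√-approx-nonNeg : ∀ q n → 0ℚ ≤ √-approx q n
√-approx-nonNeg q n = /-nonNeg (√-numerator q n) n

√-approx-lower : ∀ q n → √-approx q n * √-approx q n ≤ ∣ q ∣
√-approx-lower q n = subst₂ _≤_ (sym (/-*-/ s n s n)) (sym (∣q∣≡/ q))
  (/-mono-≤ {s ℕ.* s} {n ℕ.+ n ℕ.* suc n} {ℤ.∣ ↥ q ∣} {ℚ.denominator-1 q}
    (ℕ.≤-trans (ℕ.*-monoˡ-≤ (↧ₙ q) (isqrt-lower (X ℕ./ ↧ₙ q)))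
      (ℕ.m/n*n≤m X (↧ₙ q))))
  where
  X = ℤ.∣ ↥ q ∣ ℕ.* (suc n ℕ.* suc n)
  s = √-numerator q n

√-approx-upper : ∀ q n →
  ∣ q ∣ < (√-approx q n + + 1 / suc n) * (√-approx q n + + 1 / suc n)
√-approx-upper q n = subst₂ _<_ (sym (∣q∣≡/ q))
  (trans (sym (/-*-/ (suc s) n (suc s) n)) (cong₂ _*_ (/-suc s n) (/-suc s n)))
  (/-mono-< {ℤ.∣ ↥ q ∣} {ℚ.denominator-1 q} {suc s ℕ.* suc s} {n ℕ.+ n ℕ.* suc n} (begin-strict
    X                                           ≡⟨ ℕ.m≡m%n+[m/n]*n X (↧ₙ q) ⟩
    X ℕ.% ↧ₙ q ℕ.+ (X ℕ./ ↧ₙ q) ℕ.* ↧ₙ q        <⟨ ℕ.+-monoˡ-< _ (ℕ.m%n<n X (↧ₙ q)) ⟩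
    suc (X ℕ./ ↧ₙ q) ℕ.* ↧ₙ q                   ≤⟨ ℕ.*-monoˡ-≤ (↧ₙ q) (isqrt-upper (X ℕ./ ↧ₙ q)) ⟩
    (suc s ℕ.* suc s) ℕ.* ↧ₙ q                  ∎))
  where
  open ℕ.≤-Reasoning
  X = ℤ.∣ ↥ q ∣ ℕ.* (suc n ℕ.* suc n)
  s = √-numerator q n

private
  √-gap : ∀ p q i j η → 0ℚ ≤ η → √-approx q j + (η + η) ≤ √-approx p i →
          + 1 / suc j ≤ η → ∣ q ∣ + η * η < ∣ p ∣
  √-gap p q i j η 0≤η le 1/j≤η = begin-strict
    ∣ q ∣ + η * η                    <⟨ +-monoˡ-< (η * η) (√-approx-upper q j) ⟩
    u * u + η * η                    ≡⟨ +-identityʳ (u * u + η * η) ⟨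
    u * u + η * η + 0ℚ               ≤⟨ +-monoʳ-≤ (u * u + η * η) 0≤2uη ⟩
    u * u + η * η + (u * η + u * η)  ≡⟨ lem u η ⟩
    (u + η) * (u + η)                ≤⟨ *-mono-≤ 0≤u+η (√-approx-nonNeg p i) u+η≤s u+η≤s ⟩
    √-approx p i * √-approx p i      ≤⟨ √-approx-lower p i ⟩
    ∣ p ∣                            ∎
    where
    open ≤-Reasoning
    open +-*-Solver using (solve; _:+_; _:*_; _:=_)
    lem : ∀ u e → u * u + e * e + (u * e + u * e) ≡ (u + e) * (u + e)
    lem = solve 2 (λ u e → u :* u :+ e :* e :+ (u :* e :+ u :* e)
                           := (u :+ e) :* (u :+ e)) refl
    u : ℚ
    u = √-approx q j + + 1 / suc j
    0≤u : 0ℚ ≤ u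
    0≤u = +-mono-≤ (√-approx-nonNeg q j) (/-nonNeg 1 j)
    0≤u+η : 0ℚ ≤ u + η
    0≤u+η = +-mono-≤ 0≤u 0≤η
    0≤uη : 0ℚ ≤ u * η
    0≤uη = subst (_≤ u * η) (*-zeroʳ u) (*-monoˡ-≤-nonNeg u {{nonNegative 0≤u}} 0≤η)
    0≤2uη : 0ℚ ≤ u * η + u * η
    0≤2uη = +-mono-≤ 0≤uη 0≤uη
    u+η≤s : u + η ≤ √-approx p i
    u+η≤s = ≤-trans (+-monoˡ-≤ η (+-monoʳ-≤ (√-approx q j) 1/j≤η))
      (≤-trans (≤-reflexive (+-assoc (√-approx q j) η η)) le)

  √-close : ∀ p q i j {ε} → 0ℚ < ε → ∣ p - q ∣ < (½ * ε) * (½ * ε) →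
            + 1 / suc j ≤ ½ * ε → √-approx p i < √-approx q j + ε
  √-close p q i j {ε} 0<ε p-q<η² 1/j≤η = ≰⇒> λ le → <-irrefl refl (begin-strict
    ∣ q ∣ + η * η        <⟨ √-gap p q i j η (<⇒≤ (½-pos 0<ε))
                              (subst (λ z → √-approx q j + z ≤ √-approx p i) (sym (½+½ ε)) le)
                              1/j≤η ⟩
    ∣ p ∣                ≤⟨ ∣p∣≤∣q∣+∣p-q∣ p q ⟩
    ∣ q ∣ + ∣ p - q ∣    <⟨ +-monoʳ-< ∣ q ∣ p-q<η² ⟩
    ∣ q ∣ + η * η        ∎)
    where
    open ≤-Reasoning
    η : ℚ
    η = ½ * ε

  √-square-close : ∀ q n {B δ} → 0ℚ < δ → ∣ √-approx q n ∣ < B → + 1 / suc n ≤ δ →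
    ∣ √-approx q n * √-approx q n - ∣ q ∣ ∣ < (B + B + 1ℚ) * δ
  √-square-close q n {B} {δ} 0<δ s<B t≤δ = ∣p∣<q
    (≤-<-trans (subst (s * s - ∣ q ∣ ≤_) (+-inverseʳ ∣ q ∣)
      (+-monoˡ-≤ (- ∣ q ∣) (√-approx-lower q n))) 0<Cδ)
    (subst (_< C * δ) (sym (p-q-swap (s * s) ∣ q ∣)) (p<q+r⇒p-q<r (begin-strict
      ∣ q ∣                        <⟨ √-approx-upper q n ⟩
      (s + t) * (s + t)            ≡⟨ lem s t ⟩
      s * s + (s + s + t) * t      ≤⟨ +-monoʳ-≤ (s * s) (*-mono-≤ 0≤s+s+t (<⇒≤ 0<δ)
                                        (+-mono-≤ (+-mono-≤ s≤B s≤B) t≤1) t≤δ) ⟩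
      s * s + C * δ                ∎)))
    where
    open ≤-Reasoning
    open +-*-Solver using (solve; _:+_; _:*_; _:=_)
    s t C : ℚ
    s = √-approx q n
    t = + 1 / suc n
    C = B + B + 1ℚ
    lem : ∀ s t → (s + t) * (s + t) ≡ s * s + (s + s + t) * t
    lem = solve 2 (λ s t → (s :+ t) :* (s :+ t) := s :* s :+ (s :+ s :+ t) :* t) refl
    0≤s+s+t : 0ℚ ≤ s + s + t
    0≤s+s+t = +-mono-≤ (+-mono-≤ (√-approx-nonNeg q n) (√-approx-nonNeg q n)) (/-nonNeg 1 n)
    s≤B : s ≤ B
    s≤B = ≤-trans (p≤∣p∣ s) (<⇒≤ s<B)
    0<B : 0ℚ < B
    0<B = ≤-<-trans (0≤∣p∣ s) s<B
    0<Cδ : 0ℚ < C * δ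
    0<Cδ = *-pos (+-mono-< (+-mono-< 0<B 0<B) (positive⁻¹ 1ℚ)) 0<δ
    t≤1 : t ≤ 1ℚ
    t≤1 = /-mono-≤ {1} {n} {1} {0} (ℕ.s≤s ℕ.z≤n)

-- For negative x this is the square root of ∣ x ∣.
√ℝ : ℝ → ℝ
√ℝ x .seq n = √-approx (seq x n) n
√ℝ x .cauchy ε 0<ε =
  let N , p = cauchy x ((½ * ε) * (½ * ε)) (*-pos (½-pos 0<ε) (½-pos 0<ε))
      M , a = archimedean (½-pos 0<ε)
      close : ∀ i j → N ℕ.⊔ M ℕ.≤ i → N ℕ.⊔ M ℕ.≤ j → seq′ i < seq′ j + ε
      close i j hi hj = √-close (seq x i) (seq x j) i j 0<ε
        (p i j (ℕ.m⊔n≤o⇒m≤o N M hi) (ℕ.m⊔n≤o⇒m≤o N M hj)) (a j (ℕ.m⊔n≤o⇒n≤o N M hj))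
  in N ℕ.⊔ M , λ i j hi hj → ∣p∣<q (p<q+r⇒p-q<r (close i j hi hj))
       (subst (_< ε) (sym (p-q-swap (seq′ i) (seq′ j))) (p<q+r⇒p-q<r (close j i hj hi)))
  where
  seq′ : ℕ → ℚ
  seq′ n = √-approx (seq x n) n

√ℝ-nonNeg : ∀ x → 0ℝ ≤ℝ √ℝ x
√ℝ-nonNeg x ε 0<ε = 0 , λ n _ → +-mono-≤ (√-approx-nonNeg (seq x n) n) (<⇒≤ 0<ε)

√ℝ-square : ∀ x → √ℝ x *ℝ √ℝ x ≃ℝ ∣ x ∣ℝ
√ℝ-square x ε 0<ε =
  let B , 0<B , N , b = bounded (√ℝ x)
      δ , 0<δ , eq = divide 0<ε (+-mono-< (+-mono-< 0<B 0<B) (positive⁻¹ 1ℚ))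
      M , a = archimedean 0<δ
  in N ℕ.⊔ M , λ n h → subst (∣ seq (√ℝ x) n * seq (√ℝ x) n - ∣ seq x n ∣ ∣ <_) eq
       (√-square-close (seq x n) n 0<δ (b n (ℕ.m⊔n≤o⇒m≤o N M h)) (a n (ℕ.m⊔n≤o⇒n≤o N M h)))

infix 4 _⟶_ _~_

_⟶_ : (ℕ → ℝ) → ℝ → Set
a ⟶ L = ∀ ε → 0ℝ <ℝ ε → ∃ λ N → ∀ n → N ℕ.≤ n → ∣ a n -ℝ L ∣ℝ <ℝ ε

-- f - h = o(h)
_~_ : (ℕ → ℝ) → (ℕ → ℝ) → Set
f ~ h = ∀ ε → 0ℝ <ℝ ε → ∃ λ N → ∀ n → N ℕ.≤ n → ∣ f n -ℝ h n ∣ℝ ≤ℝ ε *ℝ ∣ h n ∣ℝ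

-- Let τ and α count all valued bracketings and those with value v₀, indexed by
-- the number of arrows and scaled by 4m per variable. Since s ⇒ t is v₀ exactly
-- if t is and s is not, τₙ₊₁ = Σ τᵢ τₙ₋ᵢ and
-- αₙ₊₁ = Σ (τᵢ - αᵢ) αₙ₋ᵢ; moreover τₖ = Cₖ / 4ᵏ⁺¹ has sum ½. As τ decreases, the
-- terms of these convolutions with K ≤ i ≤ n - K contribute at most
-- 2 (½ - Σᵢ<ₖ τᵢ) τₙ₊₁. If A = Σ αᵢ and L (½ + 2A) = A, the remaining terms
-- give αₙ₊₁ - L τₙ₊₁ ≈ Σᵢ<ₖ (τᵢ - 2αᵢ) (αₙ₋ᵢ - L τₙ₋ᵢ), and
-- |τᵢ - 2αᵢ| ≤ τᵢ makes this halve any bound on |αₙ / τₙ - L|. So αₙ / τₙ → L.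
-- Summing the second recurrence gives A² + ½ A = 1 / (4m), hence
-- (4A + 1)² = (m + 4) / m and L = ½ (1 - √ (m / (m + 4))). All bounds are rational:
-- L and A are replaced by approximations, and w stands for an approximate √.

module Submission where

open import Data.Bool.Base using (Bool; true; false)
open import Data.Nat.Base as ℕ using (ℕ; zero; suc)
import Data.Nat.Properties as ℕ
open import Data.Nat.ListAction using (sum)
import Data.Integer.Base as ℤ
import Data.Integer.Properties as ℤ
open import Data.Rational.Base hiding (_≃_)
open import Data.Rational.Properties
open import Data.Rational.Solver using (module +-*-Solver)
import Data.Rational.Unnormalised.Base as ℚᵘ
import Data.Rational.Unnormalised.Properties as ℚᵘ
open import Data.Fin.Base as Fin using (Fin; toℕ)
open import Data.List.Base using (List; []; _∷_; _++_; map; length; filter; concat; concatMap;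
  cartesianProductWith; allFin; upTo; applyUpTo; tabulate)
open import Data.List.Properties using (map-cong-local)
open import Data.List.Membership.Propositional.Properties using (∈-upTo⁻)
import Data.List.Relation.Unary.All as All
open import Data.Product.Base using (∃; _×_; _,_)
open import Data.Sum.Base using (inj₁; inj₂)
open import Data.Vec.Base using (Vec; []; _∷_; take; drop)
open import Function.Base using (_∘_; id)
open import Relation.Binary.PropositionalEquality
open import Relation.Nullary using (does; yes; no; contradiction)
open import Relation.Unary using (Decidable)
open import Defs
open +-*-Solver using (solve; _:+_; _:*_; _:-_; :-_; _:=_; con)

-- No limit of the ratios τₙ₊₁ / τₙ is used; monotonicity of `τ` replaces it. Write τ′ for
-- `τ (suc N)`, S for the sum of τᵢ over i < K, H for the sum of `τ i * τ (N ∸ i)` over i < K, and M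
-- for the middle of the convolution. Symmetry gives τ′ = 2H + M, and since `τ` decreases, H ≥ S τ′.
-- Hence M + 2 (H - S τ′) = 2 (½ - S) τ′: the middle terms and the replacement of `τ (N ∸ i)` by τ′
-- are both paid for by the same tail. This replacement also forces the equation for L: beside the
-- contracting part there remains τ′ times the sum of (1 - 2L) αᵢ - L τᵢ, which tends to zero
-- exactly if (1 - 2L) A = ½ L. So 1 - 2L is the natural parameter, and `w` stands for it.

+-nonNeg : ∀ {p q} → 0ℚ ≤ p → 0ℚ ≤ q → 0ℚ ≤ p + q
+-nonNeg = +-mono-≤

*-nonNeg : ∀ {p q} → 0ℚ ≤ p → 0ℚ ≤ q → 0ℚ ≤ p * q
*-nonNeg {p} {q} 0≤p 0≤q =
  nonNegative⁻¹ (p * q) {{nonNeg*nonNeg⇒nonNeg p {{nonNegative 0≤p}} q {{nonNegative 0≤q}}}}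

*-pos : ∀ {p q} → 0ℚ < p → 0ℚ < q → 0ℚ < p * q
*-pos {p} {q} 0<p 0<q = positive⁻¹ (p * q) {{pos*pos⇒pos p {{positive 0<p}} q {{positive 0<q}}}}

*-monoˡ : ∀ {p q r} → 0ℚ ≤ r → p ≤ q → r * p ≤ r * q
*-monoˡ {r = r} 0≤r = *-monoˡ-≤-nonNeg r {{nonNegative 0≤r}}

*-monoʳ : ∀ {p q r} → 0ℚ ≤ r → p ≤ q → p * r ≤ q * r
*-monoʳ {r = r} 0≤r = *-monoʳ-≤-nonNeg r {{nonNegative 0≤r}}

*-mono : ∀ {p q r s} → 0ℚ ≤ p → 0ℚ ≤ s → p ≤ q → r ≤ s → p * r ≤ q * s
*-mono 0≤p 0≤s p≤q r≤s = ≤-trans (*-monoˡ 0≤p r≤s) (*-monoʳ 0≤s p≤q)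

scale≤ : ∀ {s x} → 0ℚ ≤ x → s ≤ 1ℚ → s * x ≤ x
scale≤ {s} {x} 0≤x s≤1 = subst (s * x ≤_) (*-identityˡ x) (*-monoʳ 0≤x s≤1)

≤-+ : ∀ {p q} r → 0ℚ ≤ r → q ≡ p + r → p ≤ q
≤-+ {p} r 0≤r refl = subst (_≤ p + r) (+-identityʳ p) (+-monoʳ-≤ p 0≤r)

q-p-nonNeg : ∀ {p q} → p ≤ q → 0ℚ ≤ q - p
q-p-nonNeg {p} {q} p≤q = subst (_≤ q - p) (+-inverseʳ p) (+-monoˡ-≤ (- p) p≤q)

∣∣≤ : ∀ {p q} → - q ≤ p → p ≤ q → ∣ p ∣ ≤ q
∣∣≤ {p} {q} -q≤p p≤q with ∣p∣≡p∨∣p∣≡-p p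
... | inj₁ eq = subst (_≤ q) (sym eq) p≤q
... | inj₂ eq = subst₂ _≤_ (sym eq) (solve 1 (λ q → :- (:- q) := q) refl q) (neg-antimono-≤ -q≤p)

∣-∣-bounded : ∀ {p q r} → 0ℚ ≤ p → 0ℚ ≤ q → p ≤ r → q ≤ r → ∣ p - q ∣ ≤ r
∣-∣-bounded {p} {q} {r} 0≤p 0≤q p≤r q≤r = ∣∣≤
  (≤-+ (p + (r - q)) (+-nonNeg 0≤p (q-p-nonNeg q≤r))
    (solve 3 (λ p q r → p :- q := (:- r) :+ (p :+ (r :- q))) refl p q r))
  (≤-+ (q + (r - p)) (+-nonNeg 0≤q (q-p-nonNeg p≤r))
    (solve 3 (λ p q r → r := (p :- q) :+ (q :+ (r :- p))) refl p q r))

∣*∣≤ : ∀ {p q} r s → ∣ p ∣ ≤ r → ∣ q ∣ ≤ s → ∣ p * q ∣ ≤ r * s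
∣*∣≤ {p} {q} r s p≤r q≤s = subst (_≤ r * s) (sym (∣p*q∣≡∣p∣*∣q∣ p q))
  (*-mono (0≤∣p∣ p) (≤-trans (0≤∣p∣ q) q≤s) p≤r q≤s)

∣+∣≤ : ∀ {p q r s} → ∣ p ∣ ≤ r → ∣ q ∣ ≤ s → ∣ p + q ∣ ≤ r + s
∣+∣≤ {p} {q} p≤r q≤s = ≤-trans (∣p+q∣≤∣p∣+∣q∣ p q) (+-mono-≤ p≤r q≤s)

-- Finite sums

Σ< : ℕ → (ℕ → ℚ) → ℚ
Σ< zero    f = 0ℚ
Σ< (suc n) f = f 0 + Σ< n (f ∘ suc)

Σ-cong : ∀ n {f h} → (∀ i → i ℕ.< n → f i ≡ h i) → Σ< n f ≡ Σ< n h
Σ-cong zero    eq = refl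
Σ-cong (suc n) eq = cong₂ _+_ (eq 0 ℕ.z<s) (Σ-cong n λ i i<n → eq (suc i) (ℕ.s<s i<n))

Σ-mono : ∀ n {f h} → (∀ i → i ℕ.< n → f i ≤ h i) → Σ< n f ≤ Σ< n h
Σ-mono zero    le = ≤-refl
Σ-mono (suc n) le = +-mono-≤ (le 0 ℕ.z<s) (Σ-mono n λ i i<n → le (suc i) (ℕ.s<s i<n))

Σ-zero : ∀ n → Σ< n (λ _ → 0ℚ) ≡ 0ℚ
Σ-zero zero    = refl
Σ-zero (suc n) = trans (+-identityˡ _) (Σ-zero n)

Σ-nonNeg : ∀ n {f} → (∀ i → 0ℚ ≤ f i) → 0ℚ ≤ Σ< n f
Σ-nonNeg n {f} 0≤f = subst (_≤ Σ< n f) (Σ-zero n) (Σ-mono n λ i _ → 0≤f i)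

Σ-+ : ∀ n f h → Σ< n (λ i → f i + h i) ≡ Σ< n f + Σ< n h
Σ-+ zero    f h = refl
Σ-+ (suc n) f h = trans (cong (f 0 + h 0 +_) (Σ-+ n (f ∘ suc) (h ∘ suc)))
  (solve 4 (λ a b c d → a :+ b :+ (c :+ d) := a :+ c :+ (b :+ d)) refl
    (f 0) (h 0) (Σ< n (f ∘ suc)) (Σ< n (h ∘ suc)))

Σ-*ˡ : ∀ n c f → Σ< n (λ i → c * f i) ≡ c * Σ< n f
Σ-*ˡ zero    c f = sym (*-zeroʳ c)
Σ-*ˡ (suc n) c f = trans (cong (c * f 0 +_) (Σ-*ˡ n c (f ∘ suc)))
  (sym (*-distribˡ-+ c (f 0) (Σ< n (f ∘ suc))))

Σ-*ʳ : ∀ n c f → Σ< n (λ i → f i * c) ≡ Σ< n f * c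
Σ-*ʳ n c f = trans (Σ-cong n λ i _ → *-comm (f i) c) (trans (Σ-*ˡ n c f) (*-comm c (Σ< n f)))

Σ-minus : ∀ n f h → Σ< n (λ i → f i - h i) ≡ Σ< n f - Σ< n h
Σ-minus n f h = trans (Σ-+ n f (-_ ∘ h)) (cong (Σ< n f +_)
  (trans (Σ-cong n λ i _ → solve 1 (λ x → :- x := (:- con 1ℚ) :* x) refl (h i))
    (trans (Σ-*ˡ n (- 1ℚ) h) (solve 1 (λ x → (:- con 1ℚ) :* x := :- x) refl (Σ< n h)))))

Σ-∣∣ : ∀ n {f h} → (∀ i → i ℕ.< n → ∣ f i ∣ ≤ h i) → ∣ Σ< n f ∣ ≤ Σ< n h
Σ-∣∣ zero    le = ≤-refl
Σ-∣∣ (suc n) le = ∣+∣≤ (le 0 ℕ.z<s) (Σ-∣∣ n λ i i<n → le (suc i) (ℕ.s<s i<n))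

Σ-last : ∀ n f → Σ< (suc n) f ≡ Σ< n f + f n
Σ-last zero    f = +-comm (f 0) 0ℚ
Σ-last (suc n) f = trans (cong (f 0 +_) (Σ-last n (f ∘ suc)))
  (sym (+-assoc (f 0) (Σ< n (f ∘ suc)) (f (suc n))))

Σ-split : ∀ m n f → Σ< (m ℕ.+ n) f ≡ Σ< m f + Σ< n (λ i → f (m ℕ.+ i))
Σ-split zero    n f = sym (+-identityˡ _)
Σ-split (suc m) n f = trans (cong (f 0 +_) (Σ-split m n (f ∘ suc)))
  (sym (+-assoc (f 0) (Σ< m (f ∘ suc)) (Σ< n (λ i → f (suc m ℕ.+ i)))))

Σ-reverse : ∀ n f → Σ< (suc n) f ≡ Σ< (suc n) (λ i → f (n ℕ.∸ i))
Σ-reverse zero    f = refl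
Σ-reverse (suc n) f = trans (Σ-last (suc n) f)
  (trans (cong (_+ f (suc n)) (Σ-reverse n f)) (+-comm _ (f (suc n))))

-- Reversing everything after the first `K` terms turns the last `K` terms into another initial
-- segment; reversing the middle once more restores its order. Writing `N` as `K + (K + p)` keeps
-- the two ends disjoint.
Σ-ends : ∀ K p f → let N = K ℕ.+ (K ℕ.+ p) in
  Σ< (suc N) f ≡ Σ< K (λ i → f i + f (N ℕ.∸ i)) + Σ< (suc p) (λ i → f (K ℕ.+ i))
Σ-ends K p f = begin
  Σ< (suc N) f
    ≡⟨ cong (λ n → Σ< n f) (ℕ.+-suc K (K ℕ.+ p)) ⟨
  Σ< (K ℕ.+ suc (K ℕ.+ p)) f
    ≡⟨ Σ-split K _ f ⟩
  Σ< K f + Σ< (suc (K ℕ.+ p)) h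
    ≡⟨ cong (Σ< K f +_) (Σ-reverse (K ℕ.+ p) h) ⟩
  Σ< K f + Σ< (suc (K ℕ.+ p)) h′
    ≡⟨ cong (λ n → Σ< K f + Σ< n h′) (ℕ.+-suc K p) ⟨
  Σ< K f + Σ< (K ℕ.+ suc p) h′
    ≡⟨ cong (Σ< K f +_) (Σ-split K (suc p) h′) ⟩
  Σ< K f + (Σ< K h′ + Σ< (suc p) (λ i → h′ (K ℕ.+ i)))
    ≡⟨ cong (λ x → Σ< K f + (Σ< K h′ + x)) (trans
         (Σ-cong (suc p) λ i _ → cong h (ℕ.[m+n]∸[m+o]≡n∸o K p i))
         (sym (Σ-reverse p h))) ⟩
  Σ< K f + (Σ< K h′ + Σ< (suc p) h)
    ≡⟨ +-assoc (Σ< K f) (Σ< K h′) (Σ< (suc p) h) ⟨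
  Σ< K f + Σ< K h′ + Σ< (suc p) h
    ≡⟨ cong (λ x → Σ< K f + x + Σ< (suc p) h)
         (Σ-cong K λ i i<K → cong f (sym (ℕ.+-∸-assoc K (ℕ.≤-trans (ℕ.<⇒≤ i<K) (ℕ.m≤m+n K p))))) ⟩
  Σ< K f + Σ< K (λ i → f (N ℕ.∸ i)) + Σ< (suc p) h
    ≡⟨ cong (_+ Σ< (suc p) h) (Σ-+ K f (λ i → f (N ℕ.∸ i))) ⟨
  Σ< K (λ i → f i + f (N ℕ.∸ i)) + Σ< (suc p) h ∎
  where
  open ≡-Reasoning
  N = K ℕ.+ (K ℕ.+ p)
  h h′ : ℕ → ℚ
  h i = f (K ℕ.+ i)
  h′ i = h (K ℕ.+ p ℕ.∸ i)

-- Natural numbers in ℚ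

-- Defined by recursion rather than as a fraction, so that `ι (suc n)` unfolds to `1ℚ + ι n`, a form
-- the ring solver can work with.
ι : ℕ → ℚ
ι zero    = 0ℚ
ι (suc n) = 1ℚ + ι n

3ℚ 4ℚ 5ℚ 6ℚ 9ℚ 10ℚ 12ℚ 16ℚ ¼ : ℚ
3ℚ = ι 3
4ℚ = ι 4
5ℚ = ι 5
6ℚ = ι 6
9ℚ = ι 9
10ℚ = ι 10
12ℚ = ι 12
16ℚ = ι 16
¼ = ½ * ½

ι-+ : ∀ m n → ι (m ℕ.+ n) ≡ ι m + ι n
ι-+ zero    n = sym (+-identityˡ (ι n))
ι-+ (suc m) n = trans (cong (1ℚ +_) (ι-+ m n)) (sym (+-assoc 1ℚ (ι m) (ι n)))

ι-* : ∀ m n → ι (m ℕ.* n) ≡ ι m * ι n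
ι-* zero    n = sym (*-zeroˡ (ι n))
ι-* (suc m) n = trans (ι-+ n (m ℕ.* n)) (trans (cong (ι n +_) (ι-* m n))
  (solve 2 (λ x y → y :+ x :* y := (con 1ℚ :+ x) :* y) refl (ι m) (ι n)))

0≤ι : ∀ n → 0ℚ ≤ ι n
0≤ι zero    = ≤-refl
0≤ι (suc n) = +-nonNeg (nonNegative⁻¹ 1ℚ) (0≤ι n)

0<ι : ∀ n → 0ℚ < ι (suc n)
0<ι n = +-mono-<-≤ (positive⁻¹ 1ℚ) (0≤ι n)

ι-mono : ∀ {m n} → m ℕ.≤ n → ι m ≤ ι n
ι-mono {n = n} ℕ.z≤n = 0≤ι n
ι-mono (ℕ.s≤s m≤n) = +-monoʳ-≤ 1ℚ (ι-mono m≤n)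

cancel-≤ : ∀ {p q r} → 0ℚ < r → p * r ≤ q * r → p ≤ q
cancel-≤ {r = r} 0<r = *-cancelʳ-≤-pos r {{positive 0<r}}

cancel-≡ : ∀ {p q r} → 0ℚ < r → p * r ≡ q * r → p ≡ q
cancel-≡ 0<r eq = ≤-antisym (cancel-≤ 0<r (≤-reflexive eq)) (cancel-≤ 0<r (≤-reflexive (sym eq)))

toℚᵘ-ι : ∀ n → toℚᵘ (ι n) ℚᵘ.≃ ℚᵘ.mkℚᵘ (ℤ.+ n) 0
toℚᵘ-ι zero    = ℚᵘ.≃-refl
toℚᵘ-ι (suc n) = begin
  toℚᵘ (1ℚ + ι n)                    ≈⟨ toℚᵘ-homo-+ 1ℚ (ι n) ⟩
  ℚᵘ.1ℚᵘ ℚᵘ.+ toℚᵘ (ι n)             ≈⟨ ℚᵘ.+-congʳ ℚᵘ.1ℚᵘ (toℚᵘ-ι n) ⟩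
  ℚᵘ.1ℚᵘ ℚᵘ.+ ℚᵘ.mkℚᵘ (ℤ.+ n) 0        ≈⟨ ℚᵘ.*≡* (cong (λ i → (ℤ.+ 1 ℤ.+ i) ℤ.* ℤ.+ 1) (ℤ.*-identityʳ (ℤ.+ n))) ⟩
  ℚᵘ.mkℚᵘ (ℤ.+ suc n) 0                ∎
  where open ℚᵘ.≃-Reasoning

÷ℕ-ι : ∀ a b → (a ÷ℕ suc b) * ι (suc b) ≡ ι a
÷ℕ-ι a b = toℚᵘ-injective (begin
  toℚᵘ ((a ÷ℕ suc b) * ι (suc b))                ≈⟨ toℚᵘ-homo-* (a ÷ℕ suc b) (ι (suc b)) ⟩
  toℚᵘ (a ÷ℕ suc b) ℚᵘ.* toℚᵘ (ι (suc b))        ≈⟨ ℚᵘ.*-cong (toℚᵘ-fromℚᵘ (ℚᵘ.mkℚᵘ (ℤ.+ a) b)) (toℚᵘ-ι (suc b)) ⟩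
  ℚᵘ.mkℚᵘ (ℤ.+ a) b ℚᵘ.* ℚᵘ.mkℚᵘ (ℤ.+ suc b) 0       ≈⟨ ℚᵘ.*≡* (trans (ℤ.*-identityʳ _)
                                                      (cong (λ n → ℤ.+ a ℤ.* ℤ.+ n) (sym (ℕ.*-identityʳ (suc b))))) ⟩
  ℚᵘ.mkℚᵘ (ℤ.+ a) 0                                ≈⟨ toℚᵘ-ι a ⟨
  toℚᵘ (ι a)                                     ∎)
  where open ℚᵘ.≃-Reasoning

inv : ℕ → ℚ
inv n = 1 ÷ℕ suc n

inv-ι : ∀ n → inv n * ι (suc n) ≡ 1ℚ
inv-ι n = trans (÷ℕ-ι 1 n) (+-identityʳ 1ℚ)

0≤inv : ∀ n → 0ℚ ≤ inv n
0≤inv n = cancel-≤ (0<ι n) (subst₂ _≤_ (sym (*-zeroˡ (ι (suc n)))) (sym (inv-ι n)) (nonNegative⁻¹ 1ℚ))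

inv-antitone : ∀ {m n} → m ℕ.≤ n → inv n ≤ inv m
inv-antitone {m} {n} m≤n = cancel-≤ (0<ι n) (subst (_≤ inv m * ι (suc n))
  (trans (inv-ι m) (sym (inv-ι n))) (*-monoˡ (0≤inv m) (ι-mono (ℕ.s≤s m≤n))))

-- Each contraction step halves the error; recording only the improvement from 1 / (k + 1) to 1 / (k
-- + 2) makes the Archimedean property enough, without powers of ½.
½inv≤inv-suc : ∀ k → ½ * inv k ≤ inv (suc k)
½inv≤inv-suc k = ≤-+ (x * y * (½ * s)) (*-nonNeg (*-nonNeg (0≤inv k) (0≤inv (suc k)))
    (*-nonNeg (nonNegative⁻¹ ½) (0≤ι k)))
  (begin
    y                                     ≡⟨ *-identityʳ y ⟨
    y * 1ℚ                                ≡⟨ cong (y *_) (inv-ι k) ⟨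
    y * (x * (1ℚ + s))                    ≡⟨ solve 3 (λ x y s → y :* (x :* (con 1ℚ :+ s)) :=
                                               con ½ :* x :* (y :* (con 1ℚ :+ (con 1ℚ :+ s)))
                                               :+ x :* y :* (con ½ :* s)) refl x y s ⟩
    ½ * x * (y * ι (suc (suc k))) + x * y * (½ * s) ≡⟨ cong (λ z → ½ * x * z + x * y * (½ * s)) (inv-ι (suc k)) ⟩
    ½ * x * 1ℚ + x * y * (½ * s)          ≡⟨ cong (_+ x * y * (½ * s)) (*-identityʳ (½ * x)) ⟩
    ½ * x + x * y * (½ * s)               ∎)
  where
  open ≡-Reasoning
  x = inv k
  y = inv (suc k)
  s = ι k

inv-small : ∀ {ε} → 0ℚ < ε → ∃ λ n → inv n ≤ ε
inv-small {mkℚ (ℤ.+ zero) d c} (*<* (ℤ.+<+ ()))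
-- The field `d` is the denominator minus one, so `inv d` has the same denominator as `ε` and the
-- least positive numerator.
inv-small {ε@(mkℚ (ℤ.+ suc a) d c)} _ = d , cancel-≤ (0<ι d) (subst₂ _≤_
  (trans (+-identityʳ 1ℚ) (sym (inv-ι d)))
  (trans (sym (÷ℕ-ι (suc a) d)) (cong (_* ι (suc d)) (↥p/↧p≡p ε)))
  (ι-mono {1} {suc a} (ℕ.s≤s ℕ.z≤n)))
inv-small {mkℚ ℤ.-[1+ n ] d c} (*<* ())

-- Convolution recurrences

conv : (ℕ → ℚ) → (ℕ → ℚ) → ℕ → ℚ
conv x y n = Σ< (suc n) λ i → x i * y (n ℕ.∸ i)

conv-ends : ∀ x y K p → let N = K ℕ.+ (K ℕ.+ p) in
  conv x y N ≡ Σ< K (λ i → x i * y (N ℕ.∸ i) + x (N ℕ.∸ i) * y i)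
             + Σ< (suc p) (λ i → x (K ℕ.+ i) * y (N ℕ.∸ (K ℕ.+ i)))
conv-ends x y K p = trans (Σ-ends K p λ i → x i * y (N ℕ.∸ i))
  (cong (_+ Σ< (suc p) (λ i → x (K ℕ.+ i) * y (N ℕ.∸ (K ℕ.+ i))))
    (Σ-cong K λ i i<K → cong (λ j → x i * y (N ℕ.∸ i) + x (N ℕ.∸ i) * y j)
      (ℕ.m∸[m∸n]≡n (ℕ.≤-trans (ℕ.<⇒≤ i<K) (ℕ.m≤m+n K _)))))
  where N = K ℕ.+ (K ℕ.+ p)

antitone : ∀ {x : ℕ → ℚ} → (∀ n → x (suc n) ≤ x n) → ∀ {i j} → i ℕ.≤′ j → x j ≤ x i
antitone dec ℕ.≤′-refl       = ≤-refl
antitone dec (ℕ.≤′-step i≤j) = ≤-trans (dec _) (antitone dec i≤j)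

-- The tail of a series with sum ½, expressed by its partial sum. It bounds every truncation error
-- below.
deficit : (ℕ → ℚ) → ℕ → ℚ
deficit τ K = ½ - Σ< K τ

-- The claimed limit when w = √ (m / (m + 4)).
mix : ℚ → ℚ
mix w = ½ * (1ℚ - w)

mix-nonNeg : ∀ {w} → w ≤ 1ℚ → 0ℚ ≤ mix w
mix-nonNeg w≤1 = *-nonNeg (nonNegative⁻¹ ½) (q-p-nonNeg w≤1)

mix≤1 : ∀ {w} → 0ℚ ≤ w → mix w ≤ 1ℚ
mix≤1 {w} 0≤w = ≤-+ (½ * (1ℚ + w)) (*-nonNeg (nonNegative⁻¹ ½) (+-nonNeg (nonNegative⁻¹ 1ℚ) 0≤w))
  (solve 1 (λ w → con 1ℚ := con ½ :* (con 1ℚ :- w) :+ con ½ :* (con 1ℚ :+ w)) refl w)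

-- One contraction step for the error α - Lτ

module Contraction
  (τ α : ℕ → ℚ)
  (0≤α : ∀ n → 0ℚ ≤ α n) (α≤τ : ∀ n → α n ≤ τ n)
  (τ-decreasing : ∀ n → τ (suc n) ≤ τ n)
  (τ-conv : ∀ n → τ (suc n) ≡ conv τ τ n)
  (α-conv : ∀ n → α (suc n) ≡ conv (λ i → τ i - α i) α n)
  where

  0≤τ : ∀ n → 0ℚ ≤ τ n
  0≤τ n = ≤-trans (0≤α n) (α≤τ n)

  ν : ℕ → ℚ
  ν n = τ n - α n

  0≤ν : ∀ n → 0ℚ ≤ ν n
  0≤ν n = q-p-nonNeg (α≤τ n)

  ν≤τ : ∀ n → ν n ≤ τ n
  ν≤τ n = ≤-+ (α n) (0≤α n) (solve 2 (λ t a → t := t :- a :+ a) refl (τ n) (α n))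

  -- With L = `mix w`, so that w = 1 - 2L, the equation L (½ + 2A) = A reads A w = L · ½. This is
  -- the failure of that equation when A and ½ are replaced by partial sums and `w` is only
  -- approximate.
  defect : ℚ → ℕ → ℚ
  defect w K = Σ< K α * w - mix w * Σ< K τ

  module _ (w : ℚ) (0≤w : 0ℚ ≤ w) (w≤1 : w ≤ 1ℚ) (K p : ℕ) where
    private
      N = K ℕ.+ (K ℕ.+ p)
      L = mix w
      τ′ α′ H Mτ Mα C S : ℚ
      τ′ = τ (suc N)
      α′ = α (suc N)
      H = Σ< K λ i → τ i * τ (N ℕ.∸ i)
      Mτ = Σ< (suc p) λ i → τ (K ℕ.+ i) * τ (N ℕ.∸ (K ℕ.+ i))
      Mα = Σ< (suc p) λ i → ν (K ℕ.+ i) * α (N ℕ.∸ (K ℕ.+ i))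
      C = defect w K
      S = Σ< K τ

      c P Q : ℕ → ℚ
      c i = α i * w - L * τ i
      P i = (ν i - α i) * (α (N ℕ.∸ i) - L * τ (N ℕ.∸ i))
      Q i = c i * (τ (N ℕ.∸ i) - τ′)

      0≤L = mix-nonNeg w≤1
      L≤1 = mix≤1 0≤w

      τ-split : τ′ ≡ H + H + Mτ
      τ-split = trans (τ-conv N) (trans (conv-ends τ τ K p) (cong (_+ Mτ)
        (trans (Σ-cong K λ i _ → cong (τ i * τ (N ℕ.∸ i) +_) (*-comm (τ (N ℕ.∸ i)) (τ i)))
          (Σ-+ K (λ i → τ i * τ (N ℕ.∸ i)) λ i → τ i * τ (N ℕ.∸ i)))))

      -- In the paired end terms, `α (N ∸ i)` is replaced by its deviation from `L * τ (N ∸ i)`,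
      -- which gives `P`. Because 1 - 2L = w, the remainder is `c i * τ (N ∸ i)`; comparing it with
      -- `c i * τ′` gives `Q`, and the sum of the `c i` is the defect.
      error-split : α′ - L * τ′ ≡ Σ< K P + Σ< K Q + C * τ′ + (Mα - L * Mτ)
      error-split = begin
        α′ - L * τ′
          ≡⟨ cong₂ (λ a t → a - L * t) (trans (α-conv N) (conv-ends ν α K p))
                                       (trans (τ-conv N) (conv-ends τ τ K p)) ⟩
        Σ< K f + Mα - L * (Σ< K h + Mτ)
          ≡⟨ solve 5 (λ f a L h t → f :+ a :- L :* (h :+ t) := f :- L :* h :+ (a :- L :* t)) refl
               (Σ< K f) Mα L (Σ< K h) Mτ ⟩
        Σ< K f - L * Σ< K h + (Mα - L * Mτ)
          ≡⟨ cong (λ x → x + (Mα - L * Mτ)) (begin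
               Σ< K f - L * Σ< K h
                 ≡⟨ cong (λ x → Σ< K f - x) (Σ-*ˡ K L h) ⟨
               Σ< K f - Σ< K (λ i → L * h i)
                 ≡⟨ Σ-minus K f (λ i → L * h i) ⟨
               Σ< K (λ i → f i - L * h i)
                 ≡⟨ Σ-cong K (λ i _ → pointwise (τ i) (α i) (τ (N ℕ.∸ i)) (α (N ℕ.∸ i)) τ′ w) ⟩
               Σ< K (λ i → P i + Q i + c i * τ′)
                 ≡⟨ Σ-+ K (λ i → P i + Q i) (λ i → c i * τ′) ⟩
               Σ< K (λ i → P i + Q i) + Σ< K (λ i → c i * τ′)
                 ≡⟨ cong₂ _+_ (Σ-+ K P Q) (trans (Σ-*ʳ K τ′ c) (cong (_* τ′) (begin
                      Σ< K c
                        ≡⟨ Σ-minus K (λ i → α i * w) (λ i → L * τ i) ⟩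
                      Σ< K (λ i → α i * w) - Σ< K (λ i → L * τ i)
                        ≡⟨ cong₂ _-_ (Σ-*ʳ K w α) (Σ-*ˡ K L τ) ⟩
                      C ∎))) ⟩
               Σ< K P + Σ< K Q + C * τ′ ∎) ⟩
        Σ< K P + Σ< K Q + C * τ′ + (Mα - L * Mτ) ∎
        where
        open ≡-Reasoning
        f h : ℕ → ℚ
        f i = ν i * α (N ℕ.∸ i) + ν (N ℕ.∸ i) * α i
        h i = τ i * τ (N ℕ.∸ i) + τ (N ℕ.∸ i) * τ i
        pointwise : ∀ t a t₁ a₁ t₂ w →
          (t - a) * a₁ + (t₁ - a₁) * a - mix w * (t * t₁ + t₁ * t) ≡
          (t - a - a) * (a₁ - mix w * t₁) + (a * w - mix w * t) * (t₁ - t₂)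
            + (a * w - mix w * t) * t₂
        pointwise = solve 6 (λ t a t₁ a₁ t₂ w → let M = con ½ :* (con 1ℚ :- w) in
          (t :- a) :* a₁ :+ (t₁ :- a₁) :* a :- M :* (t :* t₁ :+ t₁ :* t) :=
          (t :- a :- a) :* (a₁ :- M :* t₁) :+ (a :* w :- M :* t) :* (t₁ :- t₂)
            :+ (a :* w :- M :* t) :* t₂) refl

      τ′≤ : ∀ i → τ′ ≤ τ (N ℕ.∸ i)
      τ′≤ i = antitone τ-decreasing (ℕ.≤⇒≤′ (ℕ.≤-trans (ℕ.m∸n≤m N i) (ℕ.n≤1+n N)))

      Sτ′≤H : S * τ′ ≤ H
      Sτ′≤H = subst (_≤ H) (Σ-*ʳ K τ′ τ) (Σ-mono K λ i _ → *-monoˡ (0≤τ i) (τ′≤ i))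

      0≤Mτ : 0ℚ ≤ Mτ
      0≤Mτ = Σ-nonNeg (suc p) λ i → *-nonNeg (0≤τ (K ℕ.+ i)) (0≤τ (N ℕ.∸ (K ℕ.+ i)))

      ∣c∣≤τ : ∀ i → ∣ c i ∣ ≤ τ i
      ∣c∣≤τ i = ∣-∣-bounded (*-nonNeg (0≤α i) 0≤w) (*-nonNeg 0≤L (0≤τ i))
        (≤-trans (subst (_≤ α i) (*-comm w (α i)) (scale≤ (0≤α i) w≤1)) (α≤τ i))
        (scale≤ (0≤τ i) L≤1)

      ∣ΣQ∣≤ : ∣ Σ< K Q ∣ ≤ H - S * τ′
      ∣ΣQ∣≤ = ≤-trans
        (Σ-∣∣ K λ i _ → ∣*∣≤ (τ i) (τ (N ℕ.∸ i) - τ′) (∣c∣≤τ i)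
          (≤-reflexive (0≤p⇒∣p∣≡p (q-p-nonNeg (τ′≤ i)))))
        (≤-reflexive (begin
          Σ< K (λ i → τ i * (τ (N ℕ.∸ i) - τ′))
            ≡⟨ Σ-cong K (λ i _ → solve 3 (λ a b c → a :* (b :- c) := a :* b :- a :* c) refl
                 (τ i) (τ (N ℕ.∸ i)) τ′) ⟩
          Σ< K (λ i → τ i * τ (N ℕ.∸ i) - τ i * τ′)
            ≡⟨ Σ-minus K (λ i → τ i * τ (N ℕ.∸ i)) (λ i → τ i * τ′) ⟩
          H - Σ< K (λ i → τ i * τ′)
            ≡⟨ cong (λ x → H - x) (Σ-*ʳ K τ′ τ) ⟩
          H - S * τ′ ∎))
        where open ≡-Reasoning

      ∣M∣≤ : ∣ Mα - L * Mτ ∣ ≤ Mτ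
      ∣M∣≤ = ∣-∣-bounded
        (Σ-nonNeg (suc p) λ i → *-nonNeg (0≤ν (K ℕ.+ i)) (0≤α (N ℕ.∸ (K ℕ.+ i))))
        (*-nonNeg 0≤L 0≤Mτ)
        (Σ-mono (suc p) λ i _ → *-mono (0≤ν (K ℕ.+ i)) (0≤τ (N ℕ.∸ (K ℕ.+ i)))
          (ν≤τ (K ℕ.+ i)) (α≤τ (N ℕ.∸ (K ℕ.+ i))))
        (scale≤ 0≤Mτ L≤1)

    -- The factor ½ arises because `H` occurs twice in `τ′` by symmetry, whereas the deviations are
    -- weighted by `ν i - α i`, at most `τ i` in absolute value, and hence contribute only `θ * H`.
    contraction : ∀ θ → 0ℚ ≤ θ →
      (∀ i → i ℕ.< K → ∣ α (N ℕ.∸ i) - L * τ (N ℕ.∸ i) ∣ ≤ θ * τ (N ℕ.∸ i)) →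
      ∣ α (suc N) - L * τ (suc N) ∣ ≤
        (½ * θ + (∣ defect w K ∣ + (deficit τ K + deficit τ K))) * τ (suc N)
    contraction θ 0≤θ hyp = begin
      ∣ α′ - L * τ′ ∣
        ≡⟨ cong ∣_∣ error-split ⟩
      ∣ Σ< K P + Σ< K Q + C * τ′ + (Mα - L * Mτ) ∣
        ≤⟨ ∣+∣≤ (∣+∣≤ (∣+∣≤ ∣ΣP∣≤ ∣ΣQ∣≤) ∣Cτ′∣≤) ∣M∣≤ ⟩
      θ * H + (H - S * τ′) + ∣ C ∣ * τ′ + Mτ
        -- Twice the deficit times `τ′` is 2 (H - S τ′) + Mτ. Only one of the two copies of H - S τ′
        -- is needed, so the other one is slack.
        ≤⟨ ≤-+ (½ * θ * Mτ + (H - S * τ′))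
             (+-nonNeg (*-nonNeg (*-nonNeg (nonNegative⁻¹ ½) 0≤θ) 0≤Mτ) (q-p-nonNeg Sτ′≤H))
             (trans (cong ((½ * θ + (∣ C ∣ + (deficit τ K + deficit τ K))) *_) τ-split)
               (trans (final θ H Mτ ∣ C ∣ S)
                 (cong (λ t → θ * H + (H - S * t) + ∣ C ∣ * t + Mτ + (½ * θ * Mτ + (H - S * t)))
                   (sym τ-split)))) ⟩
      (½ * θ + (∣ C ∣ + (deficit τ K + deficit τ K))) * τ′ ∎
      where
      open ≤-Reasoning
      ∣ΣP∣≤ : ∣ Σ< K P ∣ ≤ θ * H
      ∣ΣP∣≤ = ≤-trans
        (Σ-∣∣ K λ i i<K → ∣*∣≤ (τ i) (θ * τ (N ℕ.∸ i))
          (∣-∣-bounded (0≤ν i) (0≤α i) (ν≤τ i) (α≤τ i)) (hyp i i<K))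
        (≤-reflexive (trans
          (Σ-cong K λ i _ → solve 3 (λ a b c → a :* (b :* c) := b :* (a :* c)) refl
            (τ i) θ (τ (N ℕ.∸ i)))
          (Σ-*ˡ K θ λ i → τ i * τ (N ℕ.∸ i))))
      ∣Cτ′∣≤ : ∣ C * τ′ ∣ ≤ ∣ C ∣ * τ′
      ∣Cτ′∣≤ = ∣*∣≤ ∣ C ∣ τ′ ≤-refl (≤-reflexive (0≤p⇒∣p∣≡p (0≤τ (suc N))))
      final : ∀ θ H M C S →
        (½ * θ + (C + ((½ - S) + (½ - S)))) * (H + H + M) ≡
        θ * H + (H - S * (H + H + M)) + C * (H + H + M) + M + (½ * θ * M + (H - S * (H + H + M)))
      final = solve 5 (λ θ H M C S → let T = H :+ H :+ M in
        (con ½ :* θ :+ (C :+ ((con ½ :- S) :+ (con ½ :- S)))) :* T :=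
        θ :* H :+ (H :- S :* T) :+ C :* T :+ M :+ (con ½ :* θ :* M :+ (H :- S :* T))) refl

-- Partial sums of convolutions

Σ-triangle : ∀ x y K → Σ< K (conv x y) ≡ Σ< K λ i → x i * Σ< (K ℕ.∸ i) y
Σ-triangle x y zero    = refl
Σ-triangle x y (suc K) = begin
  Σ< (suc K) (conv x y)
    ≡⟨ Σ-last K (conv x y) ⟩
  Σ< K (conv x y) + conv x y K
    ≡⟨ cong (_+ conv x y K) (Σ-triangle x y K) ⟩
  Σ< K f + conv x y K
    ≡⟨ cong (_+ conv x y K) (trans (sym (+-identityʳ (Σ< K f))) (cong (Σ< K f +_)
         (sym (trans (cong (λ n → x K * Σ< n y) (ℕ.n∸n≡0 K)) (*-zeroʳ (x K)))))) ⟩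
  Σ< K f + f K + conv x y K
    ≡⟨ cong (_+ conv x y K) (Σ-last K f) ⟨
  Σ< (suc K) f + conv x y K
    ≡⟨ Σ-+ (suc K) f (λ i → x i * y (K ℕ.∸ i)) ⟨
  Σ< (suc K) (λ i → f i + x i * y (K ℕ.∸ i))
    ≡⟨ Σ-cong (suc K) (λ i i≤K → trans (sym (*-distribˡ-+ (x i) (Σ< (K ℕ.∸ i) y) (y (K ℕ.∸ i)))) (cong (x i *_)
         (trans (sym (Σ-last (K ℕ.∸ i) y))
           (cong (λ n → Σ< n y) (sym (ℕ.+-∸-assoc 1 (ℕ.s≤s⁻¹ i≤K))))))) ⟩
  Σ< (suc K) (λ i → x i * Σ< (suc K ℕ.∸ i) y) ∎
  where
  open ≡-Reasoning
  f : ℕ → ℚ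
  f i = x i * Σ< (K ℕ.∸ i) y

-- The part i + j ≥ K of the square i, j < K.
corner : (ℕ → ℚ) → (ℕ → ℚ) → ℕ → ℚ
corner x y K = Σ< K λ i → x i * Σ< i λ j → y (K ℕ.∸ i ℕ.+ j)

-- Row `i` of the square splits at column `K ∸ i`: the left piece belongs to the triangle of
-- complete convolutions, the right piece to the corner.
Σ-conv : ∀ x y K → Σ< K (conv x y) + corner x y K ≡ Σ< K x * Σ< K y
Σ-conv x y K = begin
  Σ< K (conv x y) + corner x y K
    ≡⟨ cong (_+ corner x y K) (Σ-triangle x y K) ⟩
  Σ< K (λ i → x i * Σ< (K ℕ.∸ i) y) + corner x y K
    ≡⟨ Σ-+ K (λ i → x i * Σ< (K ℕ.∸ i) y) (λ i → x i * tail i) ⟨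
  Σ< K (λ i → x i * Σ< (K ℕ.∸ i) y + x i * tail i)
    ≡⟨ Σ-cong K (λ i i<K → trans (sym (*-distribˡ-+ (x i) (Σ< (K ℕ.∸ i) y) (tail i))) (cong (x i *_)
         (trans (sym (Σ-split (K ℕ.∸ i) i y)) (cong (λ n → Σ< n y) (ℕ.m∸n+n≡m (ℕ.<⇒≤ i<K)))))) ⟩
  Σ< K (λ i → x i * Σ< K y)
    ≡⟨ Σ-*ʳ K (Σ< K y) x ⟩
  Σ< K x * Σ< K y ∎
  where
  open ≡-Reasoning
  tail : ℕ → ℚ
  tail i = Σ< i λ j → y (K ℕ.∸ i ℕ.+ j)

corner-nonNeg : ∀ {x y} → (∀ n → 0ℚ ≤ x n) → (∀ n → 0ℚ ≤ y n) → ∀ K → 0ℚ ≤ corner x y K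
corner-nonNeg 0≤x 0≤y K = Σ-nonNeg K λ i → *-nonNeg (0≤x i) (Σ-nonNeg i λ j → 0≤y (K ℕ.∸ i ℕ.+ j))

corner-mono : ∀ {x y x′ y′} → (∀ n → 0ℚ ≤ x n) → (∀ n → 0ℚ ≤ y′ n) →
              (∀ n → x n ≤ x′ n) → (∀ n → y n ≤ y′ n) → ∀ K → corner x y K ≤ corner x′ y′ K
corner-mono 0≤x 0≤y′ x≤x′ y≤y′ K = Σ-mono K λ i _ →
  *-mono (0≤x i) (Σ-nonNeg i λ j → 0≤y′ (K ℕ.∸ i ℕ.+ j)) (x≤x′ i)
    (Σ-mono i λ j _ → y≤y′ (K ℕ.∸ i ℕ.+ j))

-- A finite form of the generating function identity Z = z₀ + X Y at argument 1. Truncation leaves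
-- the two explicit nonnegative errors `z K` and `corner x y K` when the sequences are nonnegative.
Σ-recurrence : ∀ z x y → (∀ n → z (suc n) ≡ conv x y n) → ∀ K →
               Σ< K z + z K + corner x y K ≡ z 0 + Σ< K x * Σ< K y
Σ-recurrence z x y z-conv K = begin
  Σ< K z + z K + corner x y K
    ≡⟨ cong (_+ corner x y K) (Σ-last K z) ⟨
  z 0 + Σ< K (z ∘ suc) + corner x y K
    ≡⟨ cong (λ s → z 0 + s + corner x y K) (Σ-cong K λ n _ → z-conv n) ⟩
  z 0 + Σ< K (conv x y) + corner x y K
    ≡⟨ +-assoc (z 0) _ _ ⟩
  z 0 + (Σ< K (conv x y) + corner x y K)
    ≡⟨ cong (z 0 +_) (Σ-conv x y K) ⟩
  z 0 + Σ< K x * Σ< K y ∎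
  where open ≡-Reasoning

-- Iterating the contraction and bounding the defect

module RatioBound
  (τ α : ℕ → ℚ)
  (0≤α : ∀ n → 0ℚ ≤ α n) (α≤τ : ∀ n → α n ≤ τ n)
  (τ-decreasing : ∀ n → τ (suc n) ≤ τ n)
  (τ-conv : ∀ n → τ (suc n) ≡ conv τ τ n)
  (α-conv : ∀ n → α (suc n) ≡ conv (λ i → τ i - α i) α n)
  (0≤deficit : ∀ K → 0ℚ ≤ deficit τ K)
  (τ₀ : τ 0 ≡ ¼)
  (q : ℚ) (0≤q : 0ℚ ≤ q) (q≤1 : q ≤ 1ℚ) (q-eq : q * (1ℚ + 16ℚ * α 0) ≡ 1ℚ)
  where
  open Contraction τ α 0≤α α≤τ τ-decreasing τ-conv α-conv

  -- The value 2η is the fixed point of θ ↦ ½ θ + η, and the distance to it is at least halved at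
  -- each step. A step at `n` uses the bound at indices no smaller than `n ∸ suc (K + K)`, hence the
  -- block length `suc (K + K)`.
  contraction-iterated : ∀ w → 0ℚ ≤ w → w ≤ 1ℚ → ∀ K {η} →
    ∣ defect w K ∣ + (deficit τ K + deficit τ K) ≤ η →
    ∀ k n → k ℕ.* suc (K ℕ.+ K) ℕ.≤ n →
    ∣ α n - mix w * τ n ∣ ≤ (inv k + (η + η)) * τ n
  contraction-iterated w 0≤w w≤1 K {η} le = go
    where
    open ≤-Reasoning
    0≤η : 0ℚ ≤ η
    0≤η = ≤-trans (+-nonNeg (0≤∣p∣ (defect w K)) (+-nonNeg (0≤deficit K) (0≤deficit K))) le
    0≤θ : ∀ k → 0ℚ ≤ inv k + (η + η)
    0≤θ k = +-nonNeg (0≤inv k) (+-nonNeg 0≤η 0≤η)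

    go : ∀ k n → k ℕ.* suc (K ℕ.+ K) ℕ.≤ n → ∣ α n - mix w * τ n ∣ ≤ (inv k + (η + η)) * τ n
    -- The iteration starts from the trivial bound: `α n` and `mix w * τ n` both lie between 0 and
    -- `τ n`.
    go zero n _ = begin
      ∣ α n - mix w * τ n ∣      ≤⟨ ∣-∣-bounded (0≤α n) (*-nonNeg (mix-nonNeg w≤1) (0≤τ n)) (α≤τ n)
                                     (scale≤ (0≤τ n) (mix≤1 0≤w)) ⟩
      τ n                        ≡⟨ *-identityˡ (τ n) ⟨
      1ℚ * τ n                   ≤⟨ *-monoʳ {1ℚ} {1ℚ + (η + η)} (0≤τ n) (≤-+ (η + η) (+-nonNeg 0≤η 0≤η) refl) ⟩
      (inv 0 + (η + η)) * τ n    ∎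
    go (suc k) n le′ = subst (λ n → ∣ α n - mix w * τ n ∣ ≤ (inv (suc k) + (η + η)) * τ n) n≡ (begin
      ∣ α (suc N) - mix w * τ (suc N) ∣
        ≤⟨ contraction w 0≤w w≤1 K p (inv k + (η + η)) (0≤θ k)
             (λ i i<K → go k (N ℕ.∸ i) (ℕ.≤-trans p-large (N∸i-large i i<K))) ⟩
      (½ * (inv k + (η + η)) + (∣ defect w K ∣ + (deficit τ K + deficit τ K))) * τ (suc N)
        ≤⟨ *-monoʳ (0≤τ (suc N)) (begin
             ½ * (inv k + (η + η)) + (∣ defect w K ∣ + (deficit τ K + deficit τ K))
               ≤⟨ +-monoʳ-≤ (½ * (inv k + (η + η))) le ⟩
             ½ * (inv k + (η + η)) + η
               ≡⟨ solve 2 (λ x y → con ½ :* (x :+ (y :+ y)) :+ y := con ½ :* x :+ (y :+ y)) refl (inv k) η ⟩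
             ½ * inv k + (η + η)
               ≤⟨ +-monoˡ-≤ (η + η) (½inv≤inv-suc k) ⟩
             inv (suc k) + (η + η) ∎) ⟩
      (inv (suc k) + (η + η)) * τ (suc N) ∎)
      where
      p = n ℕ.∸ suc (K ℕ.+ K)
      N = K ℕ.+ (K ℕ.+ p)
      n≡ : suc N ≡ n
      n≡ = trans (cong suc (sym (ℕ.+-assoc K K p)))
        (ℕ.m+[n∸m]≡n (ℕ.≤-trans (ℕ.m≤m+n (suc (K ℕ.+ K)) _) le′))
      p-large : k ℕ.* suc (K ℕ.+ K) ℕ.≤ p
      p-large = subst (ℕ._≤ p) (ℕ.m+n∸m≡n (suc (K ℕ.+ K)) _) (ℕ.∸-monoˡ-≤ (suc (K ℕ.+ K)) le′)
      N∸i-large : ∀ i → i ℕ.< K → p ℕ.≤ N ℕ.∸ i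
      N∸i-large i i<K = ℕ.≤-trans (ℕ.m≤n+m p K)
        (subst (ℕ._≤ N ℕ.∸ i) (ℕ.m+n∸m≡n K (K ℕ.+ p)) (ℕ.∸-monoʳ-≤ N (ℕ.<⇒≤ i<K)))

  module _ (K : ℕ) where
    private
      A S d E : ℚ
      A = Σ< K α
      S = Σ< K τ
      d = deficit τ K
      -- This collects all that truncation at `K` changes in A² + ½ A = α₀: the missing part of the
      -- sum ½, the corner and the last term.
      E = d * A + (corner ν α K + α K)

      0≤A : 0ℚ ≤ A
      0≤A = Σ-nonNeg K 0≤α

      A≤S : A ≤ S
      A≤S = Σ-mono K λ i _ → α≤τ i

      0≤d = 0≤deficit K

      0≤E : 0ℚ ≤ E
      0≤E = +-nonNeg (*-nonNeg 0≤d 0≤A) (+-nonNeg (corner-nonNeg 0≤ν 0≤α K) (0≤α K))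

      quadratic : A * A + ½ * A ≡ α 0 - E
      quadratic = begin
        A * A + ½ * A
          ≡⟨ solve 4 (λ A S R a → A :* A :+ con ½ :* A :=
               A :+ a :+ R :- (S :- A) :* A :- ((con ½ :- S) :* A :+ (R :+ a)))
               refl A S (corner ν α K) (α K) ⟩
        A + α K + corner ν α K - (S - A) * A - E
          ≡⟨ cong (λ x → x - (S - A) * A - E) (Σ-recurrence α ν α α-conv K) ⟩
        α 0 + Σ< K ν * A - (S - A) * A - E
          ≡⟨ cong (λ n → α 0 + n * A - (S - A) * A - E) (Σ-minus K τ α) ⟩
        α 0 + (S - A) * A - (S - A) * A - E
          ≡⟨ solve 3 (λ k x e → k :+ x :- x :- e := k :- e) refl (α 0) ((S - A) * A) E ⟩
        α 0 - E ∎
        where open ≡-Reasoning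

      -- Bounding `ν` and `α` by `τ` turns the truncation error into the one for `τ` itself, where
      -- it is explicit: corner plus last term equal ¼ + S² - S = d², and d S + d² = d (S + d) = ½
      -- d.
      E≤½d : E ≤ ½ * d
      E≤½d = begin
        d * A + (corner ν α K + α K)
          ≤⟨ +-mono-≤ (*-monoˡ 0≤d A≤S) (+-mono-≤ (corner-mono 0≤ν 0≤τ ν≤τ α≤τ K) (α≤τ K)) ⟩
        d * S + (corner τ τ K + τ K)
          ≡⟨ cong (d * S +_) (begin-equality
               corner τ τ K + τ K
                 ≡⟨ solve 3 (λ S R t → R :+ t := S :+ t :+ R :- S) refl S (corner τ τ K) (τ K) ⟩
               S + τ K + corner τ τ K - S
                 ≡⟨ cong (_- S) (Σ-recurrence τ τ τ τ-conv K) ⟩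
               τ 0 + S * S - S
                 ≡⟨ cong (λ t → t + S * S - S) τ₀ ⟩
               ¼ + S * S - S ∎) ⟩
        d * S + (¼ + S * S - S)
          ≡⟨ solve 1 (λ S → (con ½ :- S) :* S :+ (con ¼ :+ S :* S :- S) := con ½ :* (con ½ :- S)) refl S ⟩
        ½ * d ∎
        where open ≤-Reasoning

      -- Completing the square, 16 (A² + ½ A) + 1 = X², so `X` approximates 1 / √q.
      X : ℚ
      X = 4ℚ * A + 1ℚ

      0≤X : 0ℚ ≤ X
      0≤X = +-nonNeg (*-nonNeg (0≤ι 4) 0≤A) (nonNegative⁻¹ 1ℚ)

      X≤3 : X ≤ 3ℚ
      X≤3 = ≤-+ (4ℚ * (½ - A)) (*-nonNeg (0≤ι 4) (≤-trans 0≤d (+-monoʳ-≤ ½ (neg-antimono-≤ A≤S))))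
        (solve 1 (λ A → con 3ℚ := con 4ℚ :* A :+ con 1ℚ :+ con 4ℚ :* (con ½ :- A)) refl A)

      X²≤9 : X * X ≤ 9ℚ
      X²≤9 = *-mono {X} {3ℚ} {X} {3ℚ} 0≤X (0≤ι 3) X≤3 X≤3

      qX² : q * (X * X) ≡ 1ℚ - 16ℚ * (q * E)
      qX² = begin
        q * (X * X)
          ≡⟨ solve 2 (λ q A → q :* ((con 4ℚ :* A :+ con 1ℚ) :* (con 4ℚ :* A :+ con 1ℚ)) :=
               q :* (con 16ℚ :* (A :* A :+ con ½ :* A) :+ con 1ℚ)) refl q A ⟩
        q * (16ℚ * (A * A + ½ * A) + 1ℚ)
          ≡⟨ cong (λ x → q * (16ℚ * x + 1ℚ)) quadratic ⟩
        q * (16ℚ * (α 0 - E) + 1ℚ)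
          ≡⟨ solve 3 (λ q k e → q :* (con 16ℚ :* (k :- e) :+ con 1ℚ) :=
               q :* (con 1ℚ :+ con 16ℚ :* k) :- con 16ℚ :* (q :* e)) refl q (α 0) E ⟩
        q * (1ℚ + 16ℚ * α 0) - 16ℚ * (q * E)
          ≡⟨ cong (_- 16ℚ * (q * E)) q-eq ⟩
        1ℚ - 16ℚ * (q * E) ∎
        where open ≡-Reasoning

    module _ (w δ : ℚ) (0≤w : 0ℚ ≤ w) (w≤1 : w ≤ 1ℚ) (w²-close : ∣ w * w - q ∣ ≤ δ) where
      private
        0≤δ : 0ℚ ≤ δ
        0≤δ = ≤-trans (0≤∣p∣ (w * w - q)) w²-close

        ∣w²X²-1∣≤ : ∣ w * w * (X * X) - 1ℚ ∣ ≤ δ * 9ℚ + 16ℚ * (½ * d)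
        ∣w²X²-1∣≤ = begin
          ∣ w * w * (X * X) - 1ℚ ∣
            ≡⟨ cong ∣_∣ (solve 3 (λ w q Y → w :* w :* Y :- con 1ℚ :=
                 (w :* w :- q) :* Y :+ (q :* Y :- con 1ℚ)) refl w q (X * X)) ⟩
          ∣ (w * w - q) * (X * X) + (q * (X * X) - 1ℚ) ∣
            ≤⟨ ∣+∣≤ (∣*∣≤ δ 9ℚ w²-close
                 (subst (_≤ 9ℚ) (sym (0≤p⇒∣p∣≡p (*-nonNeg 0≤X 0≤X))) X²≤9)) (begin
                 ∣ q * (X * X) - 1ℚ ∣
                   ≡⟨ cong ∣_∣ (trans (cong (_- 1ℚ) qX²)
                        (solve 1 (λ x → con 1ℚ :- x :- con 1ℚ := :- x) refl (16ℚ * (q * E)))) ⟩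
                 ∣ - (16ℚ * (q * E)) ∣
                   ≡⟨ ∣-p∣≡∣p∣ (16ℚ * (q * E)) ⟩
                 ∣ 16ℚ * (q * E) ∣
                   ≡⟨ 0≤p⇒∣p∣≡p (*-nonNeg (0≤ι 16) (*-nonNeg 0≤q 0≤E)) ⟩
                 16ℚ * (q * E)
                   ≤⟨ *-monoˡ (0≤ι 16) (≤-trans (scale≤ 0≤E q≤1) E≤½d) ⟩
                 16ℚ * (½ * d) ∎) ⟩
          δ * 9ℚ + 16ℚ * (½ * d) ∎
          where open ≤-Reasoning

        -- The estimate for squares passes to the roots because the cofactor `w * X + 1ℚ` is at
        -- least 1.
        ∣wX-1∣≤ : ∣ w * X - 1ℚ ∣ ≤ δ * 9ℚ + 16ℚ * (½ * d)
        ∣wX-1∣≤ = begin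
          ∣ w * X - 1ℚ ∣
            ≡⟨ *-identityʳ ∣ w * X - 1ℚ ∣ ⟨
          ∣ w * X - 1ℚ ∣ * 1ℚ
            ≤⟨ *-monoˡ (0≤∣p∣ (w * X - 1ℚ))
                 (≤-+ (w * X) (*-nonNeg 0≤w 0≤X) (+-comm (w * X) 1ℚ)) ⟩
          ∣ w * X - 1ℚ ∣ * (w * X + 1ℚ)
            ≡⟨ cong (∣ w * X - 1ℚ ∣ *_)
                 (0≤p⇒∣p∣≡p (+-nonNeg (*-nonNeg 0≤w 0≤X) (nonNegative⁻¹ 1ℚ))) ⟨
          ∣ w * X - 1ℚ ∣ * ∣ w * X + 1ℚ ∣
            ≡⟨ ∣p*q∣≡∣p∣*∣q∣ (w * X - 1ℚ) (w * X + 1ℚ) ⟨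
          ∣ (w * X - 1ℚ) * (w * X + 1ℚ) ∣
            ≡⟨ cong ∣_∣ (solve 2 (λ w X → (w :* X :- con 1ℚ) :* (w :* X :+ con 1ℚ) :=
                 w :* w :* (X :* X) :- con 1ℚ) refl w X) ⟩
          ∣ w * w * (X * X) - 1ℚ ∣
            ≤⟨ ∣w²X²-1∣≤ ⟩
          δ * 9ℚ + 16ℚ * (½ * d) ∎
          where open ≤-Reasoning

      defect-small : ∣ defect w K ∣ + (d + d) ≤ 3ℚ * δ + 5ℚ * d
      defect-small = begin
        ∣ defect w K ∣ + (d + d)
          -- The defect is ¼ (wX - 1) plus `mix w` times the deficit: the parts ¼ (1 - w) and ½ ·
          -- `mix w` cancel.
          ≡⟨ cong (λ x → ∣ x ∣ + (d + d)) (solve 3 (λ w A S → let M = con ½ :* (con 1ℚ :- w) in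
               A :* w :- M :* S :=
               con ¼ :* (w :* (con 4ℚ :* A :+ con 1ℚ) :- con 1ℚ) :+ M :* (con ½ :- S)) refl w A S) ⟩
        ∣ ¼ * (w * X - 1ℚ) + mix w * d ∣ + (d + d)
          ≤⟨ +-monoˡ-≤ (d + d) (∣+∣≤ (∣*∣≤ ¼ (δ * 9ℚ + 16ℚ * (½ * d)) ≤-refl ∣wX-1∣≤)
               (subst (_≤ d) (sym (0≤p⇒∣p∣≡p (*-nonNeg (mix-nonNeg w≤1) 0≤d)))
                 (scale≤ 0≤d (mix≤1 0≤w)))) ⟩
        ¼ * (δ * 9ℚ + 16ℚ * (½ * d)) + d + (d + d)
          ≤⟨ ≤-+ (3ℚ * ¼ * δ) (*-nonNeg (*-nonNeg (0≤ι 3) (nonNegative⁻¹ ¼)) 0≤δ)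
               (solve 2 (λ δ d → con 3ℚ :* δ :+ con 5ℚ :* d :=
                 con ¼ :* (δ :* con 9ℚ :+ con 16ℚ :* (con ½ :* d)) :+ d :+ (d :+ d)
                 :+ con 3ℚ :* con ¼ :* δ) refl δ d) ⟩
        3ℚ * δ + 5ℚ * d ∎
        where open ≤-Reasoning

      ratio-close : ∀ k n → k ℕ.* suc (K ℕ.+ K) ℕ.≤ n →
        ∣ α n - mix w * τ n ∣ ≤ (inv k + (6ℚ * δ + 10ℚ * d)) * τ n
      ratio-close k n le = subst (λ x → ∣ α n - mix w * τ n ∣ ≤ (inv k + x) * τ n)
        (solve 2 (λ δ d → con 3ℚ :* δ :+ con 5ℚ :* d :+ (con 3ℚ :* δ :+ con 5ℚ :* d) :=
          con 6ℚ :* δ :+ con 10ℚ :* d) refl δ d)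
        (contraction-iterated w 0≤w w≤1 K defect-small k n le)

-- The scaled Catalan numbers

-- τ k = Cₖ / 4ᵏ⁺¹ with Cₖ the Catalan numbers.
τ : ℕ → ℚ
τ zero    = ¼
τ (suc k) = τ k * (suc (k ℕ.+ k) ÷ℕ (4 ℕ.+ (k ℕ.+ k)))

τ-suc : ∀ k → (ι k + (1ℚ + 1ℚ)) * τ (suc k) ≡ (ι k + ½) * τ k
τ-suc k = begin
  (s + (1ℚ + 1ℚ)) * (τ k * r)
    ≡⟨ solve 3 (λ s t r → (s :+ (con 1ℚ :+ con 1ℚ)) :* (t :* r) :=
         con ½ :* t :* (r :* (con 1ℚ :+ (con 1ℚ :+ (con 1ℚ :+ (con 1ℚ :+ (s :+ s))))))) refl s (τ k) r ⟩
  ½ * τ k * (r * (1ℚ + (1ℚ + (1ℚ + (1ℚ + (s + s))))))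
    ≡⟨ cong (λ x → ½ * τ k * (r * (1ℚ + (1ℚ + (1ℚ + (1ℚ + x)))))) (ι-+ k k) ⟨
  ½ * τ k * (r * ι (4 ℕ.+ (k ℕ.+ k)))
    ≡⟨ cong (½ * τ k *_) (÷ℕ-ι (suc (k ℕ.+ k)) (3 ℕ.+ (k ℕ.+ k))) ⟩
  ½ * τ k * (1ℚ + ι (k ℕ.+ k))
    ≡⟨ cong (λ x → ½ * τ k * (1ℚ + x)) (ι-+ k k) ⟩
  ½ * τ k * (1ℚ + (s + s))
    ≡⟨ solve 2 (λ s t → con ½ :* t :* (con 1ℚ :+ (s :+ s)) := (s :+ con ½) :* t) refl s (τ k) ⟩
  (s + ½) * τ k ∎
  where
  open ≡-Reasoning
  s = ι k
  r = suc (k ℕ.+ k) ÷ℕ (4 ℕ.+ (k ℕ.+ k))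

0<ι+2 : ∀ k → 0ℚ < ι k + (1ℚ + 1ℚ)
0<ι+2 k = +-mono-≤-< (0≤ι k) (positive⁻¹ (1ℚ + 1ℚ))

0<τ : ∀ k → 0ℚ < τ k
0<τ zero    = positive⁻¹ ¼
0<τ (suc k) = *-cancelˡ-<-nonNeg (ι k + (1ℚ + 1ℚ)) {{nonNegative (<⇒≤ (0<ι+2 k))}}
  (subst₂ _<_ (sym (*-zeroʳ (ι k + (1ℚ + 1ℚ)))) (sym (τ-suc k))
    (*-pos (+-mono-≤-< (0≤ι k) (positive⁻¹ ½)) (0<τ k)))

0≤τ : ∀ k → 0ℚ ≤ τ k
0≤τ k = <⇒≤ (0<τ k)

τ-decreasing : ∀ k → τ (suc k) ≤ τ k
τ-decreasing k = *-cancelˡ-≤-pos (ι k + (1ℚ + 1ℚ)) {{positive (0<ι+2 k)}}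
  (subst (_≤ (ι k + (1ℚ + 1ℚ)) * τ k) (sym (τ-suc k)) (*-monoʳ (0≤τ k) (+-monoʳ-≤ (ι k) ½≤2)))
  where
  ½≤2 : ½ ≤ 1ℚ + 1ℚ
  ½≤2 = ≤-+ (1ℚ + ½) (nonNegative⁻¹ (1ℚ + ½)) refl

-- The right side telescopes: by `τ-suc` its value drops by exactly `τ K` from `K` to `suc K`. This
-- yields the sum ½ of the Catalan series without generating functions.
deficit-τ : ∀ K → deficit τ K ≡ (1ℚ + 1ℚ) * (ι K + 1ℚ) * τ K
deficit-τ zero    = refl
deficit-τ (suc K) = begin
  ½ - Σ< (suc K) τ
    ≡⟨ cong (λ x → ½ - x) (Σ-last K τ) ⟩
  ½ - (Σ< K τ + τ K)
    ≡⟨ solve 2 (λ S t → con ½ :- (S :+ t) := con ½ :- S :- t) refl (Σ< K τ) (τ K) ⟩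
  ½ - Σ< K τ - τ K
    ≡⟨ cong (_- τ K) (deficit-τ K) ⟩
  (1ℚ + 1ℚ) * (ι K + 1ℚ) * τ K - τ K
    ≡⟨ solve 2 (λ s t → (con 1ℚ :+ con 1ℚ) :* (s :+ con 1ℚ) :* t :- t :=
         (con 1ℚ :+ con 1ℚ) :* ((s :+ con ½) :* t)) refl (ι K) (τ K) ⟩
  (1ℚ + 1ℚ) * ((ι K + ½) * τ K)
    ≡⟨ cong ((1ℚ + 1ℚ) *_) (τ-suc K) ⟨
  (1ℚ + 1ℚ) * ((ι K + (1ℚ + 1ℚ)) * τ (suc K))
    ≡⟨ solve 2 (λ s t → (con 1ℚ :+ con 1ℚ) :* ((s :+ (con 1ℚ :+ con 1ℚ)) :* t) :=
         (con 1ℚ :+ con 1ℚ) :* (con 1ℚ :+ s :+ con 1ℚ) :* t) refl (ι K) (τ (suc K)) ⟩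
  (1ℚ + 1ℚ) * (ι (suc K) + 1ℚ) * τ (suc K) ∎
  where open ≡-Reasoning

0≤deficit-τ : ∀ K → 0ℚ ≤ deficit τ K
0≤deficit-τ K = subst (0ℚ ≤_) (sym (deficit-τ K)) (*-nonNeg
  (*-nonNeg (nonNegative⁻¹ (1ℚ + 1ℚ)) (+-nonNeg (0≤ι K) (nonNegative⁻¹ 1ℚ))) (0≤τ K))

-- The left side decreases in `K` from ¼ at `K` = 0. With d = 2 (K + 1) τ_K the drop is (3K + 2)
-- τ_K². This elementary rate 1 / √K stands in for Stirling's formula.
deficit²-bound : ∀ K → deficit τ K * deficit τ K * ι (suc K) ≤ ¼
deficit²-bound zero    = ≤-refl
deficit²-bound (suc K) = ≤-trans (≤-+ ((3ℚ * s + (1ℚ + 1ℚ)) * (t * t))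
    (*-nonNeg (+-nonNeg (*-nonNeg (0≤ι 3) (0≤ι K)) (nonNegative⁻¹ (1ℚ + 1ℚ)))
      (*-nonNeg (0≤τ K) (0≤τ K)))
    (begin
      deficit τ K * deficit τ K * ι (suc K)
        ≡⟨ cong (λ d → d * d * ι (suc K)) (deficit-τ K) ⟩
      d₀ * d₀ * ι (suc K)
        ≡⟨ solve 2 (λ s t → let two = con 1ℚ :+ con 1ℚ ; d₀ = two :* (s :+ con 1ℚ) :* t ; d₁ = d₀ :- t in
             d₀ :* d₀ :* (con 1ℚ :+ s) :=
             d₁ :* d₁ :* (con 1ℚ :+ (con 1ℚ :+ s)) :+ (con 3ℚ :* s :+ two) :* (t :* t)) refl s t ⟩
      (d₀ - t) * (d₀ - t) * ι (suc (suc K)) + (3ℚ * s + (1ℚ + 1ℚ)) * (t * t)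
        ≡⟨ cong (λ d → d * d * ι (suc (suc K)) + (3ℚ * s + (1ℚ + 1ℚ)) * (t * t)) (begin
             d₀ - t
               ≡⟨ cong (_- t) (deficit-τ K) ⟨
             ½ - Σ< K τ - t
               ≡⟨ solve 2 (λ S t → con ½ :- S :- t := con ½ :- (S :+ t)) refl (Σ< K τ) t ⟩
             ½ - (Σ< K τ + t)
               ≡⟨ cong (λ x → ½ - x) (Σ-last K τ) ⟨
             deficit τ (suc K) ∎) ⟩
      deficit τ (suc K) * deficit τ (suc K) * ι (suc (suc K)) + (3ℚ * s + (1ℚ + 1ℚ)) * (t * t) ∎))
  (deficit²-bound K)
  where
  open ≡-Reasoning
  s = ι K
  t = τ K
  d₀ = (1ℚ + 1ℚ) * (s + 1ℚ) * t

square-cancel-≤ : ∀ {p q} → 0ℚ < q → p * p ≤ q * q → p ≤ q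
square-cancel-≤ {p} {q} 0<q p²≤q² with ≤-total p q
... | inj₁ p≤q = p≤q
... | inj₂ q≤p = cancel-≤ (<-≤-trans 0<q q≤p) (≤-trans p²≤q² (*-monoˡ (<⇒≤ 0<q) q≤p))

deficit-small : ∀ {ε} → 0ℚ < ε → ∃ λ K → deficit τ K ≤ ε
deficit-small {ε} 0<ε =
  let K , inv≤ = inv-small (*-pos 0<ε 0<ε)
  in K , square-cancel-≤ 0<ε (≤-trans
       (cancel-≤ (0<ι K) (≤-trans (deficit²-bound K)
         (subst (¼ ≤_) (sym (inv-ι K)) (≤-+ (3ℚ * ¼) (nonNegative⁻¹ (3ℚ * ¼)) refl))))
       inv≤)

-- Averaging the sum with its reversal replaces the weight `i` by half of i + (n - i) = n.
Σ-index-conv : ∀ x n → Σ< (suc n) (λ i → ι i * (x i * x (n ℕ.∸ i))) ≡ ½ * (ι n * conv x x n)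
Σ-index-conv x n = begin
  W
    ≡⟨ solve 1 (λ w → w := con ½ :* (w :+ w)) refl W ⟩
  ½ * (W + W)
    ≡⟨ cong (λ v → ½ * (W + v)) (trans (Σ-reverse n (λ i → ι i * f i))
         (Σ-cong (suc n) λ i i≤n → cong (ι (n ℕ.∸ i) *_)
           (trans (cong (λ j → x (n ℕ.∸ i) * x j) (ℕ.m∸[m∸n]≡n (ℕ.s≤s⁻¹ i≤n)))
             (*-comm (x (n ℕ.∸ i)) (x i))))) ⟩
  ½ * (W + Σ< (suc n) (λ i → ι (n ℕ.∸ i) * f i))
    ≡⟨ cong (½ *_) (Σ-+ (suc n) (λ i → ι i * f i) (λ i → ι (n ℕ.∸ i) * f i)) ⟨
  ½ * Σ< (suc n) (λ i → ι i * f i + ι (n ℕ.∸ i) * f i)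
    ≡⟨ cong (½ *_) (Σ-cong (suc n) λ i i≤n → trans (sym (*-distribʳ-+ (f i) (ι i) (ι (n ℕ.∸ i))))
         (cong (_* f i) (trans (sym (ι-+ i (n ℕ.∸ i))) (cong ι (ℕ.m+[n∸m]≡n (ℕ.s≤s⁻¹ i≤n)))))) ⟩
  ½ * Σ< (suc n) (λ i → ι n * f i)
    ≡⟨ cong (½ *_) (Σ-*ˡ (suc n) (ι n) f) ⟩
  ½ * (ι n * conv x x n) ∎
  where
  open ≡-Reasoning
  f : ℕ → ℚ
  f i = x i * x (n ℕ.∸ i)
  W = Σ< (suc n) (λ i → ι i * f i)

-- Weighting the i-th term of conv τ τ (n + 1) by i + 1 multiplies the sum by
-- (n + 3) / 2, by the symmetry i ↔ n + 1 - i; by τ-suc the weighted sum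
-- also reduces to conv τ τ n.
τ-conv : ∀ n → τ (suc n) ≡ conv τ τ n
τ-conv zero    = refl
τ-conv (suc n) = cancel-≡ (0<ι+2 (suc n)) (begin
  τ (suc (suc n)) * (ι (suc n) + two)
    ≡⟨ trans (*-comm (τ (suc (suc n))) _) (τ-suc (suc n)) ⟩
  (1ℚ + s + ½) * τ (suc n)
    ≡⟨ solve 2 (λ s t → (con 1ℚ :+ s :+ con ½) :* t :=
         (con 1ℚ :+ con 1ℚ) :* (con ¼ :* t :+ (con ½ :* (s :* t) :+ con ½ :* t))) refl s (τ (suc n)) ⟩
  two * (¼ * τ (suc n) + (½ * (s * τ (suc n)) + ½ * τ (suc n)))
    ≡⟨ cong (λ c → two * (¼ * τ (suc n) + (½ * (s * c) + ½ * c))) (τ-conv n) ⟩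
  two * (¼ * τ (suc n) + (½ * (s * conv τ τ n) + ½ * conv τ τ n))
    ≡⟨ cong (λ x → two * (¼ * τ (suc n) + x)) lower ⟨
  two * (¼ * τ (suc n) + Σ< (suc n) (λ i → (ι (suc i) + 1ℚ) * (τ (suc i) * τ (n ℕ.∸ i))))
    ≡⟨ cong (λ x → two * (x + Σ< (suc n) (λ i → (ι (suc i) + 1ℚ) * (τ (suc i) * τ (n ℕ.∸ i)))))
         (sym (*-identityˡ (¼ * τ (suc n)))) ⟩
  two * Σ< (suc (suc n)) (λ i → (ι i + 1ℚ) * f i)
    ≡⟨ cong (two *_) raise ⟩
  two * (½ * (ι (suc n) * conv τ τ (suc n)) + conv τ τ (suc n))
    ≡⟨ solve 2 (λ s c → (con 1ℚ :+ con 1ℚ) :* (con ½ :* (s :* c) :+ c) :=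
         c :* (s :+ (con 1ℚ :+ con 1ℚ))) refl (ι (suc n)) (conv τ τ (suc n)) ⟩
  conv τ τ (suc n) * (ι (suc n) + two) ∎)
  where
  open ≡-Reasoning
  two = 1ℚ + 1ℚ
  s = ι n
  f h : ℕ → ℚ
  f i = τ i * τ (suc n ℕ.∸ i)
  h i = τ i * τ (n ℕ.∸ i)
  lower : Σ< (suc n) (λ i → (ι (suc i) + 1ℚ) * (τ (suc i) * τ (n ℕ.∸ i))) ≡
          ½ * (s * conv τ τ n) + ½ * conv τ τ n
  lower = begin
    Σ< (suc n) (λ i → (1ℚ + ι i + 1ℚ) * (τ (suc i) * τ (n ℕ.∸ i)))
      ≡⟨ Σ-cong (suc n) (λ i _ → begin
           (1ℚ + ι i + 1ℚ) * (τ (suc i) * τ (n ℕ.∸ i))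
             ≡⟨ solve 3 (λ s t u → (con 1ℚ :+ s :+ con 1ℚ) :* (t :* u) :=
                  (s :+ (con 1ℚ :+ con 1ℚ)) :* t :* u) refl (ι i) (τ (suc i)) (τ (n ℕ.∸ i)) ⟩
           (ι i + two) * τ (suc i) * τ (n ℕ.∸ i)
             ≡⟨ cong (_* τ (n ℕ.∸ i)) (τ-suc i) ⟩
           (ι i + ½) * τ i * τ (n ℕ.∸ i)
             ≡⟨ solve 3 (λ s t u → (s :+ con ½) :* t :* u := s :* (t :* u) :+ con ½ :* (t :* u))
                  refl (ι i) (τ i) (τ (n ℕ.∸ i)) ⟩
           ι i * h i + ½ * h i ∎) ⟩
    Σ< (suc n) (λ i → ι i * h i + ½ * h i)
      ≡⟨ Σ-+ (suc n) (λ i → ι i * h i) (λ i → ½ * h i) ⟩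
    Σ< (suc n) (λ i → ι i * h i) + Σ< (suc n) (λ i → ½ * h i)
      ≡⟨ cong₂ _+_ (Σ-index-conv τ n) (Σ-*ˡ (suc n) ½ h) ⟩
    ½ * (s * conv τ τ n) + ½ * conv τ τ n ∎
  raise : Σ< (suc (suc n)) (λ i → (ι i + 1ℚ) * f i) ≡
          ½ * (ι (suc n) * conv τ τ (suc n)) + conv τ τ (suc n)
  raise = begin
    Σ< (suc (suc n)) (λ i → (ι i + 1ℚ) * f i)
      ≡⟨ Σ-cong (suc (suc n)) (λ i _ → trans (*-distribʳ-+ (f i) (ι i) 1ℚ)
           (cong (ι i * f i +_) (*-identityˡ (f i)))) ⟩
    Σ< (suc (suc n)) (λ i → ι i * f i + f i)
      ≡⟨ Σ-+ (suc (suc n)) (λ i → ι i * f i) f ⟩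
    Σ< (suc (suc n)) (λ i → ι i * f i) + conv τ τ (suc n)
      ≡⟨ cong (_+ conv τ τ (suc n)) (Σ-index-conv τ (suc n)) ⟩
    ½ * (ι (suc n) * conv τ τ (suc n)) + conv τ τ (suc n) ∎

-- Counting bracketings and valuations

private variable
  X Y Z : Set

ΣL : List X → (X → ℚ) → ℚ
ΣL []       f = 0ℚ
ΣL (x ∷ xs) f = f x + ΣL xs f

ΣL-cong : ∀ (xs : List X) {f h} → (∀ x → f x ≡ h x) → ΣL xs f ≡ ΣL xs h
ΣL-cong []       eq = refl
ΣL-cong (x ∷ xs) eq = cong₂ _+_ (eq x) (ΣL-cong xs eq)

ΣL-mono : ∀ (xs : List X) {f h} → (∀ x → f x ≤ h x) → ΣL xs f ≤ ΣL xs h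
ΣL-mono []       le = ≤-refl
ΣL-mono (x ∷ xs) le = +-mono-≤ (le x) (ΣL-mono xs le)

ΣL-nonNeg : ∀ (xs : List X) {f} → (∀ x → 0ℚ ≤ f x) → 0ℚ ≤ ΣL xs f
ΣL-nonNeg []       0≤f = ≤-refl
ΣL-nonNeg (x ∷ xs) 0≤f = +-nonNeg (0≤f x) (ΣL-nonNeg xs 0≤f)

ΣL-minus : ∀ (xs : List X) f h → ΣL xs (λ x → f x - h x) ≡ ΣL xs f - ΣL xs h
ΣL-minus []       f h = refl
ΣL-minus (x ∷ xs) f h = trans (cong (f x - h x +_) (ΣL-minus xs f h))
  (solve 4 (λ a b c d → a :- b :+ (c :- d) := a :+ c :- (b :+ d)) refl (f x) (h x) (ΣL xs f) (ΣL xs h))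

ΣL-*ˡ : ∀ (xs : List X) c f → ΣL xs (λ x → c * f x) ≡ c * ΣL xs f
ΣL-*ˡ []       c f = sym (*-zeroʳ c)
ΣL-*ˡ (x ∷ xs) c f = trans (cong (c * f x +_) (ΣL-*ˡ xs c f)) (sym (*-distribˡ-+ c (f x) (ΣL xs f)))

ΣL-*ʳ : ∀ (xs : List X) c f → ΣL xs (λ x → f x * c) ≡ ΣL xs f * c
ΣL-*ʳ []       c f = sym (*-zeroˡ c)
ΣL-*ʳ (x ∷ xs) c f = trans (cong (f x * c +_) (ΣL-*ʳ xs c f)) (sym (*-distribʳ-+ c (f x) (ΣL xs f)))

ΣL-++ : ∀ (xs ys : List X) f → ΣL (xs ++ ys) f ≡ ΣL xs f + ΣL ys f
ΣL-++ []       ys f = sym (+-identityˡ (ΣL ys f))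
ΣL-++ (x ∷ xs) ys f = trans (cong (f x +_) (ΣL-++ xs ys f)) (sym (+-assoc (f x) (ΣL xs f) (ΣL ys f)))

ΣL-map : ∀ (h : X → Y) xs f → ΣL (map h xs) f ≡ ΣL xs (f ∘ h)
ΣL-map h []       f = refl
ΣL-map h (x ∷ xs) f = cong (f (h x) +_) (ΣL-map h xs f)

ΣL-concatMap : ∀ (h : X → List Y) xs f → ΣL (concatMap h xs) f ≡ ΣL xs (λ x → ΣL (h x) f)
ΣL-concatMap h []       f = refl
ΣL-concatMap h (x ∷ xs) f = trans (ΣL-++ (h x) (concatMap h xs) f)
  (cong (ΣL (h x) f +_) (ΣL-concatMap h xs f))

ΣL-cartesianProductWith : ∀ (op : X → Y → Z) xs ys f →
  ΣL (cartesianProductWith op xs ys) f ≡ ΣL xs λ x → ΣL ys λ y → f (op x y)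
ΣL-cartesianProductWith op []       ys f = refl
ΣL-cartesianProductWith op (x ∷ xs) ys f = trans
  (ΣL-++ (map (op x) ys) (cartesianProductWith op xs ys) f)
  (cong₂ _+_ (ΣL-map (op x) ys f) (ΣL-cartesianProductWith op xs ys f))

ΣL-product : ∀ (xs : List X) (ys : List Y) f h →
  ΣL xs (λ x → ΣL ys λ y → f x * h y) ≡ ΣL xs f * ΣL ys h
ΣL-product xs ys f h = trans (ΣL-cong xs λ x → ΣL-*ˡ ys (f x) h) (ΣL-*ʳ xs (ΣL ys h) f)

ΣL-applyUpTo : ∀ (h : ℕ → X) n f → ΣL (applyUpTo h n) f ≡ Σ< n (f ∘ h)
ΣL-applyUpTo h zero    f = refl
ΣL-applyUpTo h (suc n) f = cong (f (h 0) +_) (ΣL-applyUpTo (h ∘ suc) n f)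

Σ-ΣL-swap : ∀ n (xs : List X) (f : ℕ → X → ℚ) →
            Σ< n (λ j → ΣL xs (f j)) ≡ ΣL xs (λ x → Σ< n λ j → f j x)
Σ-ΣL-swap n []       f = Σ-zero n
Σ-ΣL-swap n (x ∷ xs) f = trans (Σ-+ n (λ j → f j x) (λ j → ΣL xs (f j)))
  (cong (Σ< n (λ j → f j x) +_) (Σ-ΣL-swap n xs f))

indicator : Bool → ℚ
indicator true  = 1ℚ
indicator false = 0ℚ

ι-length-filter : ∀ {P : X → Set} (P? : Decidable P) xs →
                  ι (length (filter P? xs)) ≡ ΣL xs (indicator ∘ does ∘ P?)
ι-length-filter P? []       = refl
ι-length-filter P? (x ∷ xs) with does (P? x)
... | true  = cong (1ℚ +_) (ι-length-filter P? xs)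
... | false = trans (ι-length-filter P? xs) (sym (+-identityˡ _))

ι-sum : ∀ (f : ℕ → ℕ) ns → ι (sum (map f ns)) ≡ ΣL ns (ι ∘ f)
ι-sum f []       = refl
ι-sum f (n ∷ ns) = trans (ι-+ (f n) (sum (map f ns))) (cong (ι (f n) +_) (ι-sum f ns))

Σ-indicator-toℕ : ∀ {m} (p : Fin m) → Σ< m (λ j → indicator (does (toℕ p ℕ.≟ j))) ≡ 1ℚ
Σ-indicator-toℕ {suc m} Fin.zero    = trans (cong (1ℚ +_) (Σ-zero m)) (+-identityʳ 1ℚ)
Σ-indicator-toℕ {suc m} (Fin.suc p) = trans (+-identityˡ _) (Σ-indicator-toℕ p)

ΣL-valuations-split : ∀ m a b (f : Vec (Fin m) a → ℚ) (h : Vec (Fin m) b → ℚ) →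
  ΣL (valuations m (a ℕ.+ b)) (λ v → f (take a v) * h (drop a v)) ≡
  ΣL (valuations m a) f * ΣL (valuations m b) h
ΣL-valuations-split m zero    b f h = trans (ΣL-*ˡ (valuations m b) (f []) h)
  (cong (_* ΣL (valuations m b) h) (sym (+-identityʳ (f []))))
ΣL-valuations-split m (suc a) b f h = begin
  ΣL (valuations m (suc a ℕ.+ b)) (λ v → f (take (suc a) v) * h (drop (suc a) v))
    ≡⟨ ΣL-cartesianProductWith _∷_ (allFin m) (valuations m (a ℕ.+ b)) _ ⟩
  ΣL (allFin m) (λ x → ΣL (valuations m (a ℕ.+ b)) λ v → f (x ∷ take a v) * h (drop a v))
    ≡⟨ ΣL-cong (allFin m) (λ x → ΣL-valuations-split m a b (f ∘ (x ∷_)) h) ⟩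
  ΣL (allFin m) (λ x → ΣL (valuations m a) (f ∘ (x ∷_)) * ΣL (valuations m b) h)
    ≡⟨ ΣL-*ʳ (allFin m) (ΣL (valuations m b) h) _ ⟩
  ΣL (allFin m) (λ x → ΣL (valuations m a) (f ∘ (x ∷_))) * ΣL (valuations m b) h
    ≡⟨ cong (_* ΣL (valuations m b) h) (ΣL-cartesianProductWith _∷_ (allFin m) (valuations m a) f) ⟨
  ΣL (valuations m (suc a)) f * ΣL (valuations m b) h ∎
  where open ≡-Reasoning

-- A rational weight `φ` on truth values, in place of a predicate, lets the counts of all values, of
-- v₀ and of the values other than v₀ share one convolution lemma, and makes the last the difference
-- of the first two.
weight : ∀ {m} → (Fin m → ℚ) → Bracketing → ℚ
weight {m} φ t = ΣL (valuations m (leaves t)) (φ ∘ eval t)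

total : ∀ {m} → (Fin m → ℚ) → ℕ → ℚ
total φ n = ΣL (bracketings n) (weight φ)

-- Indexed by the number of arrows, as the Catalan numbers are.
total⁺ : ∀ {m} → (Fin m → ℚ) → ℕ → ℚ
total⁺ φ n = total φ (suc n)

-- The variables of `s` and `t` are disjoint, so a valuation of `s ⇒ t` is an independent pair and
-- the sum of products factors.
weight-⇒ : ∀ {m} {φ ψ χ : Fin m → ℚ} → (∀ p q → φ (p ⇒ᴳ q) ≡ ψ p * χ q) →
           ∀ s t → weight φ (s ⇒ t) ≡ weight ψ s * weight χ t
weight-⇒ {m} {ψ = ψ} {χ} φ-⇒ s t = trans
  (ΣL-cong (valuations m (leaves s ℕ.+ leaves t)) λ v → φ-⇒ _ _)
  (ΣL-valuations-split m (leaves s) (leaves t) (ψ ∘ eval s) (χ ∘ eval t))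

-- The depth bound acts as fuel, and `n` leaves never need more than `n`. Inside the recursion the
-- subtrees carry a bound larger than their own size may require; this brings them back to
-- `bracketings`.
bracketings<-depth : ∀ d d′ n → n ℕ.≤ d → n ℕ.≤ d′ → bracketings< d n ≡ bracketings< d′ n
bracketings<-depth zero    zero     n       _ _ = refl
bracketings<-depth zero    (suc d′) 0       _ _ = refl
bracketings<-depth (suc d) zero     0       _ _ = refl
bracketings<-depth (suc d) (suc d′) 0       _ _ = refl
bracketings<-depth (suc d) (suc d′) 1       _ _ = refl
bracketings<-depth (suc d) (suc d′) (suc (suc k)) (ℕ.s≤s k<d) (ℕ.s≤s k<d′) =
  cong concat (map-cong-local (All.tabulate λ {i} i∈ →
    cong₂ (cartesianProductWith _⇒_)
      (bracketings<-depth d d′ (suc i) (ℕ.≤-trans (∈-upTo⁻ i∈) k<d) (ℕ.≤-trans (∈-upTo⁻ i∈) k<d′))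
      (bracketings<-depth d d′ (suc k ℕ.∸ i) (ℕ.≤-trans (ℕ.m∸n≤m (suc k) i) k<d)
        (ℕ.≤-trans (ℕ.m∸n≤m (suc k) i) k<d′))))

total-conv : ∀ {m} {φ ψ χ : Fin m → ℚ} → (∀ p q → φ (p ⇒ᴳ q) ≡ ψ p * χ q) →
             ∀ k → total φ (suc (suc k)) ≡ conv (total⁺ ψ) (total⁺ χ) k
total-conv {φ = φ} {ψ} {χ} φ-⇒ k = begin
  total φ (suc (suc k))
    ≡⟨ ΣL-concatMap split (upTo (suc k)) (weight φ) ⟩
  ΣL (upTo (suc k)) (λ i → ΣL (split i) (weight φ))
    ≡⟨ ΣL-applyUpTo id (suc k) (λ i → ΣL (split i) (weight φ)) ⟩
  Σ< (suc k) (λ i → ΣL (split i) (weight φ))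
    ≡⟨ Σ-cong (suc k) (λ i i≤k → begin
         ΣL (split i) (weight φ)
           ≡⟨ ΣL-cartesianProductWith _⇒_ (left i) (right i) (weight φ) ⟩
         ΣL (left i) (λ s → ΣL (right i) λ t → weight φ (s ⇒ t))
           ≡⟨ ΣL-cong (left i) (λ s → ΣL-cong (right i) λ t → weight-⇒ {φ = φ} {ψ} {χ} φ-⇒ s t) ⟩
         ΣL (left i) (λ s → ΣL (right i) λ t → weight ψ s * weight χ t)
           ≡⟨ ΣL-product (left i) (right i) (weight ψ) (weight χ) ⟩
         ΣL (left i) (weight ψ) * ΣL (right i) (weight χ)
           ≡⟨ cong₂ (λ xs ys → ΣL xs (weight ψ) * ΣL ys (weight χ))
                (bracketings<-depth (suc k) (suc i) (suc i) i≤k ℕ.≤-refl)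
                (trans (bracketings<-depth (suc k) (suc k ℕ.∸ i) (suc k ℕ.∸ i) (ℕ.m∸n≤m (suc k) i) ℕ.≤-refl)
                  (cong bracketings (ℕ.+-∸-assoc 1 (ℕ.s≤s⁻¹ i≤k)))) ⟩
         total ψ (suc i) * total χ (suc (k ℕ.∸ i)) ∎) ⟩
  conv (total⁺ ψ) (total⁺ χ) k ∎
  where
  open ≡-Reasoning
  left right split : ℕ → List Bracketing
  left i = bracketings< (suc k) (suc i)
  right i = bracketings< (suc k) (suc k ℕ.∸ i)
  split i = cartesianProductWith _⇒_ (left i) (right i)

one isZero isNonZero : ∀ {m} → Fin m → ℚ
one       p = 1ℚ
isZero    p = indicator (does (toℕ p ℕ.≟ 0))
isNonZero p = one p - isZero p

-- An implication takes the value v₀ only in the branch that returns `q`. This needs the top to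
-- differ from v₀, which is where m ≥ 2 enters: in a one-element chain the implication is v₀
-- although its premise is v₀.
isZero-⇒ : ∀ {k} (p q : Fin (2 ℕ.+ k)) → isZero (p ⇒ᴳ q) ≡ isNonZero p * isZero q
isZero-⇒ p q with toℕ p ℕ.≤? toℕ q
isZero-⇒ p           (Fin.suc q) | yes _   = sym (*-zeroʳ (isNonZero p))
isZero-⇒ Fin.zero    Fin.zero    | yes _   = refl
isZero-⇒ (Fin.suc p) Fin.zero    | yes ()
isZero-⇒ Fin.zero    q           | no p≰q  = contradiction ℕ.z≤n p≰q
isZero-⇒ (Fin.suc p) q           | no _    = sym (*-identityˡ (isZero q))

indicator-nonNeg : ∀ b → 0ℚ ≤ indicator b
indicator-nonNeg true  = nonNegative⁻¹ 1ℚ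
indicator-nonNeg false = ≤-refl

indicator≤1 : ∀ b → indicator b ≤ 1ℚ
indicator≤1 true  = ≤-refl
indicator≤1 false = nonNegative⁻¹ 1ℚ

total-mono : ∀ {m} {φ ψ : Fin m → ℚ} → (∀ p → φ p ≤ ψ p) → ∀ n → total φ n ≤ total ψ n
total-mono {m} φ≤ψ n = ΣL-mono (bracketings n) λ t →
  ΣL-mono (valuations m (leaves t)) λ v → φ≤ψ (eval t v)

total-nonNeg : ∀ {m} {φ : Fin m → ℚ} → (∀ p → 0ℚ ≤ φ p) → ∀ n → 0ℚ ≤ total φ n
total-nonNeg {m} 0≤φ n = ΣL-nonNeg (bracketings n) λ t →
  ΣL-nonNeg (valuations m (leaves t)) λ v → 0≤φ (eval t v)

total-minus : ∀ {m} (φ ψ : Fin m → ℚ) n → total (λ p → φ p - ψ p) n ≡ total φ n - total ψ n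
total-minus {m} φ ψ n = trans
  (ΣL-cong (bracketings n) λ t → ΣL-minus (valuations m (leaves t)) (φ ∘ eval t) (ψ ∘ eval t))
  (ΣL-minus (bracketings n) (weight φ) (weight ψ))

total-1 : ∀ {m} (φ : Fin m → ℚ) → total φ 1 ≡ ΣL (allFin m) φ
total-1 {m} φ = trans (+-identityʳ (weight φ leaf))
  (trans (ΣL-cartesianProductWith _∷_ (allFin m) ([] ∷ []) _)
    (ΣL-cong (allFin m) λ x → +-identityʳ (φ x)))

ΣL-tabulate-const : ∀ {m} (h : Fin m → X) c → ΣL (tabulate h) (λ _ → c) ≡ ι m * c
ΣL-tabulate-const {m = zero}  h c = sym (*-zeroˡ c)
ΣL-tabulate-const {m = suc m} h c = trans (cong (c +_) (ΣL-tabulate-const (h ∘ Fin.suc) c))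
  (solve 2 (λ c s → c :+ s :* c := (con 1ℚ :+ s) :* c) refl c (ι m))

ΣL-tabulate-zero : ∀ {m} (h : Fin m → X) f → (∀ p → f (h p) ≡ 0ℚ) → ΣL (tabulate h) f ≡ 0ℚ
ΣL-tabulate-zero {m = zero}  h f eq = refl
ΣL-tabulate-zero {m = suc m} h f eq = trans
  (cong₂ _+_ (eq Fin.zero) (ΣL-tabulate-zero (h ∘ Fin.suc) f (eq ∘ Fin.suc))) (+-identityˡ 0ℚ)

value : ∀ {m} → ValuedBracketing m → Fin m
value (t , v) = eval t v

ΣL-valuedBracketings : ∀ {m} (φ : Fin m → ℚ) n →
  ΣL (valuedBracketings m n) (φ ∘ value) ≡ total φ n
ΣL-valuedBracketings {m} φ n = trans
  (ΣL-concatMap (λ t → map (t ,_) (valuations m (leaves t))) (bracketings n) (φ ∘ value))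
  (ΣL-cong (bracketings n) λ t → ΣL-map (λ (v : Vec (Fin m) (leaves t)) → t , v) (valuations m (leaves t)) (φ ∘ value))

ι-g : ∀ m n → ι (g m n 0) ≡ total {m} isZero n
ι-g m n = trans (ι-length-filter _ (valuedBracketings m n)) (ΣL-valuedBracketings isZero n)

-- Each valued bracketing belongs to exactly one class j < m, so after exchanging the two sums each
-- contributes 1.
ι-gTotal : ∀ m n → ι (gTotal m n) ≡ total {m} one n
ι-gTotal m n = begin
  ι (sum (map (g m n) (upTo m)))
    ≡⟨ ι-sum (g m n) (upTo m) ⟩
  ΣL (upTo m) (ι ∘ g m n)
    ≡⟨ ΣL-applyUpTo id m (ι ∘ g m n) ⟩
  Σ< m (ι ∘ g m n)
    ≡⟨ Σ-cong m (λ j _ → ι-length-filter _ VB) ⟩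
  Σ< m (λ j → ΣL VB λ tv → indicator (does (toℕ (value tv) ℕ.≟ j)))
    ≡⟨ Σ-ΣL-swap m VB _ ⟩
  ΣL VB (λ tv → Σ< m λ j → indicator (does (toℕ (value tv) ℕ.≟ j)))
    ≡⟨ ΣL-cong VB (Σ-indicator-toℕ ∘ value) ⟩
  ΣL VB (λ tv → 1ℚ)
    ≡⟨ ΣL-valuedBracketings {m} one n ⟩
  total {m} one n ∎
  where
  open ≡-Reasoning
  VB = valuedBracketings m n

conv-cong : ∀ {x x′ y y′} n → (∀ i → i ℕ.≤ n → x i ≡ x′ i) → (∀ i → i ℕ.≤ n → y i ≡ y′ i) →
            conv x y n ≡ conv x′ y′ n
conv-cong n x≡x′ y≡y′ = Σ-cong (suc n) λ i i≤n →
  cong₂ _*_ (x≡x′ i (ℕ.s≤s⁻¹ i≤n)) (y≡y′ (n ℕ.∸ i) (ℕ.m∸n≤m n i))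

-- Normalising the counts

conv-unique : ∀ {x y} → x 0 ≡ y 0 → (∀ n → x (suc n) ≡ conv x x n) →
              (∀ n → y (suc n) ≡ conv y y n) → ∀ n → x n ≡ y n
conv-unique {x} {y} x₀≡y₀ x-conv y-conv n = below n n ℕ.≤-refl
  where
  below : ∀ n i → i ℕ.≤ n → x i ≡ y i
  below n       zero    _         = x₀≡y₀
  below (suc n) (suc i) (ℕ.s≤s i≤n) = trans (x-conv i)
    (trans (conv-cong {x} {y} {x} {y} i (λ j j≤i → below n j (ℕ.≤-trans j≤i i≤n))
                     (λ j j≤i → below n j (ℕ.≤-trans j≤i i≤n)))
      (sym (y-conv i)))

pow : ℚ → ℕ → ℚ
pow c zero    = 1ℚ
pow c (suc n) = c * pow c n

pow-+ : ∀ c m n → pow c (m ℕ.+ n) ≡ pow c m * pow c n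
pow-+ c zero    n = sym (*-identityˡ (pow c n))
pow-+ c (suc m) n = trans (cong (c *_) (pow-+ c m n)) (sym (*-assoc c (pow c m) (pow c n)))

0≤pow : ∀ {c} → 0ℚ ≤ c → ∀ n → 0ℚ ≤ pow c n
0≤pow 0≤c zero    = nonNegative⁻¹ 1ℚ
0≤pow 0≤c (suc n) = *-nonNeg 0≤c (0≤pow 0≤c n)

-- The exponent is `suc n` because `n` arrows join `n + 1` variables. With one factor per variable
-- the convolution recurrence is homogeneous and survives the rescaling.
rescale : ℚ → (ℕ → ℚ) → ℕ → ℚ
rescale c x n = x n * pow c (suc n)

conv-rescale : ∀ c x y n → conv x y n * pow c (suc (suc n)) ≡ conv (rescale c x) (rescale c y) n
conv-rescale c x y n = trans
  (sym (Σ-*ʳ (suc n) (pow c (suc (suc n))) (λ i → x i * y (n ℕ.∸ i))))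
  (Σ-cong (suc n) λ i i≤n → trans
    (cong (x i * y (n ℕ.∸ i) *_) (trans (cong (pow c) (index i (ℕ.s≤s⁻¹ i≤n)))
      (pow-+ c (suc i) (suc (n ℕ.∸ i)))))
    (solve 4 (λ a b p q → a :* b :* (p :* q) := a :* p :* (b :* q)) refl
      (x i) (y (n ℕ.∸ i)) (pow c (suc i)) (pow c (suc (n ℕ.∸ i)))))
  where
  index : ∀ i → i ℕ.≤ n → suc (suc n) ≡ suc i ℕ.+ suc (n ℕ.∸ i)
  index i i≤n = sym (trans (cong suc (ℕ.+-suc i (n ℕ.∸ i)))
    (cong (λ j → suc (suc j)) (ℕ.m+[n∸m]≡n i≤n)))

-- Positivity of the scaled denominator rules out the default value of `_÷ℕ_` at zero.
÷ℕ-scaled : ∀ a b c → 0ℚ < ι b * c → (a ÷ℕ b) * (ι b * c) ≡ ι a * c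
÷ℕ-scaled a zero    c 0<0 = contradiction 0<0 (<-irrefl (sym (*-zeroˡ c)))
÷ℕ-scaled a (suc b) c _   = trans (sym (*-assoc (a ÷ℕ suc b) (ι (suc b)) c)) (cong (_* c) (÷ℕ-ι a b))

-- The fraction m / (m + 4) and its approximate square roots

module Fraction (m : ℕ) where
  private
    M = suc m

  q : ℚ
  q = M ÷ℕ (M ℕ.+ 4)

  q-ι : q * (ι M + ι 4) ≡ ι M
  q-ι = trans (cong (q *_) (sym (ι-+ M 4))) (÷ℕ-ι M (m ℕ.+ 4))

  0<M+4 : 0ℚ < ι M + ι 4
  0<M+4 = +-mono-<-≤ (0<ι m) (0≤ι 4)

  0≤q : 0ℚ ≤ q
  0≤q = cancel-≤ 0<M+4 (subst₂ _≤_ (sym (*-zeroˡ (ι M + ι 4))) (sym q-ι) (0≤ι M))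

  q≤1 : q ≤ 1ℚ
  q≤1 = cancel-≤ 0<M+4 (subst₂ _≤_ (sym q-ι) (sym (*-identityˡ (ι M + ι 4)))
    (≤-+ (ι 4) (0≤ι 4) refl))

  ∣q∣≡q : ∣ q ∣ ≡ q
  ∣q∣≡q = 0≤p⇒∣p∣≡p 0≤q

  w : ℕ → ℚ
  w = seq (√ℝ (fromℚ q))

  0≤w : ∀ j → 0ℚ ≤ w j
  0≤w = √-approx-nonNeg q

  w≤1 : ∀ j → w j ≤ 1ℚ
  w≤1 j = square-cancel-≤ (positive⁻¹ 1ℚ)
    (≤-trans (√-approx-lower q j) (subst (_≤ 1ℚ) (sym ∣q∣≡q) q≤1))

  w²-close : ∀ δ → 0ℚ < δ → ∃ λ J → ∀ j → J ℕ.≤ j → ∣ w j * w j - q ∣ ≤ δ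
  w²-close δ 0<δ =
    let J , close = √ℝ-square (fromℚ q) δ 0<δ
    in J , λ j J≤j → <⇒≤ (subst (λ x → ∣ w j * w j - x ∣ < δ) ∣q∣≡q (close j J≤j))

-- Convergence of the ratios, with κ = 1 / (4m)

module Limit (k : ℕ) (κ : ℚ) (0≤κ : 0ℚ ≤ κ) (κ-ι : κ * (ι 4 * ι (2 ℕ.+ k)) ≡ 1ℚ) where
  private
    m = suc (suc k)

    ι-κ : ι m * κ ≡ ¼
    ι-κ = begin
      ι m * κ                   ≡⟨ solve 2 (λ m k → m :* k := con ¼ :* (k :* (con 4ℚ :* m))) refl (ι m) κ ⟩
      ¼ * (κ * (ι 4 * ι m))     ≡⟨ cong (¼ *_) κ-ι ⟩
      ¼                         ∎
      where open ≡-Reasoning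

    α t : ℕ → ℚ
    α = rescale κ (total⁺ (isZero {m}))
    t = rescale κ (total⁺ (one {m}))

    0≤pow-κ : ∀ n → 0ℚ ≤ pow κ n
    0≤pow-κ = 0≤pow 0≤κ

    -- Both sequences satisfy the self-convolution recurrence and start at m κ = ¼. No count of the
    -- bracketings by a Catalan formula is required.
    t≡τ : ∀ n → t n ≡ τ n
    t≡τ = conv-unique (begin
        total (one {m}) 1 * (κ * 1ℚ)
          ≡⟨ cong₂ _*_ (trans (total-1 (one {m})) (ΣL-tabulate-const {m = m} id 1ℚ)) (*-identityʳ κ) ⟩
        ι m * 1ℚ * κ
          ≡⟨ cong (_* κ) (*-identityʳ (ι m)) ⟩
        ι m * κ
          ≡⟨ ι-κ ⟩
        ¼ ∎)
      (λ n → trans (cong (_* pow κ (suc (suc n))) (total-conv {m} {one} {one} {one} (λ p q → refl) n))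
        (conv-rescale κ (total⁺ (one {m})) (total⁺ (one {m})) n))
      τ-conv
      where open ≡-Reasoning

    α₀ : α 0 ≡ κ
    α₀ = begin
      total (isZero {m}) 1 * (κ * 1ℚ)
        ≡⟨ cong₂ _*_ (trans (total-1 (isZero {m})) (cong (1ℚ +_) ΣL-suc)) (*-identityʳ κ) ⟩
      1ℚ * κ
        ≡⟨ *-identityˡ κ ⟩
      κ ∎
      where
      open ≡-Reasoning
      ΣL-suc : ΣL (tabulate {n = suc k} Fin.suc) isZero ≡ 0ℚ
      ΣL-suc = ΣL-tabulate-zero {m = suc k} Fin.suc isZero λ _ → refl

    0≤α : ∀ n → 0ℚ ≤ α n
    0≤α n = *-nonNeg (total-nonNeg (λ p → indicator-nonNeg (does (toℕ p ℕ.≟ 0))) (suc n))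
      (0≤pow-κ (suc n))

    α≤τ : ∀ n → α n ≤ τ n
    α≤τ n = subst (α n ≤_) (t≡τ n) (*-monoʳ (0≤pow-κ (suc n))
      (total-mono (λ p → indicator≤1 (does (toℕ p ℕ.≟ 0))) (suc n)))

    α-conv : ∀ n → α (suc n) ≡ conv (λ i → τ i - α i) α n
    α-conv n = begin
      total (isZero {m}) (suc (suc n)) * pow κ (suc (suc n))
        ≡⟨ cong (_* pow κ (suc (suc n))) (total-conv {m} {isZero} {isNonZero} {isZero} isZero-⇒ n) ⟩
      conv (total⁺ (isNonZero {m})) (total⁺ (isZero {m})) n * pow κ (suc (suc n))
        ≡⟨ conv-rescale κ (total⁺ (isNonZero {m})) (total⁺ (isZero {m})) n ⟩
      conv (rescale κ (total⁺ (isNonZero {m}))) α n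
        ≡⟨ conv-cong {y = α} {α} n (λ i _ → begin
             total (isNonZero {m}) (suc i) * pow κ (suc i)
               ≡⟨ cong (_* pow κ (suc i)) (total-minus (one {m}) isZero (suc i)) ⟩
             (total (one {m}) (suc i) - total (isZero {m}) (suc i)) * pow κ (suc i)
               ≡⟨ solve 3 (λ a b c → (a :- b) :* c := a :* c :- b :* c) refl
                    (total (one {m}) (suc i)) (total (isZero {m}) (suc i)) (pow κ (suc i)) ⟩
             t i - α i
               ≡⟨ cong (_- α i) (t≡τ i) ⟩
             τ i - α i ∎) (λ i _ → refl) ⟩
      conv (λ i → τ i - α i) α n ∎
      where open ≡-Reasoning

    open Fraction (suc k)

    q-eq : q * (1ℚ + 16ℚ * α 0) ≡ 1ℚ
    q-eq = cancel-≡ (0<ι (suc k)) (begin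
      q * (1ℚ + 16ℚ * α 0) * ι m
        ≡⟨ cong (λ x → q * (1ℚ + 16ℚ * x) * ι m) α₀ ⟩
      q * (1ℚ + 16ℚ * κ) * ι m
        ≡⟨ solve 3 (λ q k m → q :* (con 1ℚ :+ con 16ℚ :* k) :* m := q :* (m :+ con 16ℚ :* (m :* k)))
             refl q κ (ι m) ⟩
      q * (ι m + 16ℚ * (ι m * κ))
        ≡⟨ cong (λ x → q * (ι m + 16ℚ * x)) ι-κ ⟩
      q * (ι m + ι 4)
        ≡⟨ q-ι ⟩
      ι m
        ≡⟨ *-identityˡ (ι m) ⟨
      1ℚ * ι m ∎)
      where open ≡-Reasoning

    open RatioBound τ α 0≤α α≤τ τ-decreasing τ-conv α-conv 0≤deficit-τ refl q 0≤q q≤1 q-eq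

    r : ℕ → ℚ
    r n = g m n 0 ÷ℕ gTotal m n

    -- Numerator and denominator carry the same power of `κ`, which cancels. The index shifts
    -- because `r` counts variables and `τ` counts arrows. Positivity of `τ n` also shows that
    -- `gTotal` is nonzero here.
    r*τ : ∀ n → r (suc n) * τ n ≡ α n
    r*τ n = begin
      r (suc n) * τ n
        ≡⟨ cong (r (suc n) *_) τ≡ ⟩
      r (suc n) * (ι (gTotal m (suc n)) * pow κ (suc n))
        ≡⟨ ÷ℕ-scaled (g m (suc n) 0) (gTotal m (suc n)) (pow κ (suc n)) (subst (0ℚ <_) τ≡ (0<τ n)) ⟩
      ι (g m (suc n) 0) * pow κ (suc n)
        ≡⟨ cong (_* pow κ (suc n)) (ι-g m (suc n)) ⟩
      α n ∎
      where
      open ≡-Reasoning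
      τ≡ : τ n ≡ ι (gTotal m (suc n)) * pow κ (suc n)
      τ≡ = trans (sym (t≡τ n)) (cong (_* pow κ (suc n)) (sym (ι-gTotal m (suc n))))

    ratio-bound : ∀ n L {θ} → ∣ α n - L * τ n ∣ ≤ θ * τ n → ∣ r (suc n) - L ∣ ≤ θ
    ratio-bound n L {θ} le = cancel-≤ (0<τ n) (subst (_≤ θ * τ n) (begin
      ∣ α n - L * τ n ∣
        ≡⟨ cong (λ x → ∣ x - L * τ n ∣) (r*τ n) ⟨
      ∣ r (suc n) * τ n - L * τ n ∣
        ≡⟨ cong ∣_∣ (solve 3 (λ r L t → r :* t :- L :* t := (r :- L) :* t) refl (r (suc n)) L (τ n)) ⟩
      ∣ (r (suc n) - L) * τ n ∣
        ≡⟨ ∣p*q∣≡∣p∣*∣q∣ (r (suc n) - L) (τ n) ⟩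
      ∣ r (suc n) - L ∣ * ∣ τ n ∣
        ≡⟨ cong (∣ r (suc n) - L ∣ *_) (0≤p⇒∣p∣≡p (0≤τ n)) ⟩
      ∣ r (suc n) - L ∣ * τ n ∎) le)
      where open ≡-Reasoning

  -- The index `j` of the approximate root is independent of `n`. Stopping at half of `ε` leaves the
  -- other half as the witness of a strict inequality between reals.
  ratio-limit : ∀ ε → 0ℚ < ε → ∃ λ N → ∃ λ J → ∀ n → N ℕ.≤ n → ∀ j → J ℕ.≤ j →
                ∣ r n - mix (w j) ∣ ≤ ½ * ε
  ratio-limit ε 0<ε =
    let K , d≤u = deficit-small 0<u
        l , inv≤u = inv-small 0<u
        J , close = w²-close u 0<u
    in suc (l ℕ.* suc (K ℕ.+ K)) , J , λ where
      (suc n) (ℕ.s≤s N≤n) j J≤j → ≤-trans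
        (ratio-bound n (mix (w j)) (ratio-close K (w j) u (0≤w j) (w≤1 j) (close j J≤j) l n N≤n))
        (begin
          inv l + (6ℚ * u + 10ℚ * deficit τ K)
            ≤⟨ +-mono-≤ inv≤u (+-monoʳ-≤ (6ℚ * u) (*-monoˡ (0≤ι 10) d≤u)) ⟩
          u + (6ℚ * u + 10ℚ * u)
            -- The three errors add up to 17u = 17ε / 64, and 32ε / 64 are available.
            ≤⟨ ≤-+ (15ℚ/64 * ε) (*-nonNeg (nonNegative⁻¹ 15ℚ/64) (<⇒≤ 0<ε))
                 (solve 1 (λ e → con ½ :* e := con 1ℚ/64 :* e :+ (con 6ℚ :* (con 1ℚ/64 :* e)
                   :+ con 10ℚ :* (con 1ℚ/64 :* e)) :+ con 15ℚ/64 :* e) refl ε) ⟩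
          ½ * ε ∎)
    where
    open ≤-Reasoning
    1ℚ/64 15ℚ/64 u : ℚ
    1ℚ/64 = ¼ * ¼ * ¼
    15ℚ/64 = ι 15 * 1ℚ/64
    u = 1ℚ/64 * ε
    0<u : 0ℚ < u
    0<u = *-pos (positive⁻¹ 1ℚ/64) 0<ε

-- The limit and its asymptotics

p⊥ : ℕ → ℝ
p⊥ m = fromℚ ½ *ℝ (1ℝ -ℝ √ℝ (fromℚ (m ÷ℕ (m ℕ.+ 4))))

≃ℝ-refl : ∀ x → x ≃ℝ x
≃ℝ-refl x ε 0<ε = 0 , λ n _ → subst (λ p → ∣ p ∣ < ε) (sym (+-inverseʳ (seq x n))) 0<ε

p⊥-limit : ∀ k → (λ n → fromℚ (g (2 ℕ.+ k) n 0 ÷ℕ gTotal (2 ℕ.+ k) n)) ⟶ p⊥ (2 ℕ.+ k)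
p⊥-limit k ε (e , 0<e , M , e≤ε) =
  let N , J , close = ratio-limit e 0<e
  in N , λ n N≤n → ½ * e , *-pos (positive⁻¹ ½) 0<e , M ℕ.⊔ J , λ j le → ≤-trans
       (+-monoˡ-≤ (½ * e) (close n N≤n j (ℕ.m⊔n≤o⇒n≤o M J le)))
       (subst (_≤ seq ε j) (solve 1 (λ e → con 0ℚ :+ e := con ½ :* e :+ con ½ :* e) refl e)
         (e≤ε j (ℕ.m⊔n≤o⇒m≤o M J le)))
  where
  -- Since `inv n` is 1 / (n + 1), the predecessor makes this 1 / (4m).
  open Limit k (inv (ℕ.pred (4 ℕ.* (2 ℕ.+ k)))) (0≤inv (ℕ.pred (4 ℕ.* (2 ℕ.+ k))))
    (trans (cong (inv (ℕ.pred (4 ℕ.* (2 ℕ.+ k))) *_) (sym (ι-* 4 (2 ℕ.+ k))))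
      (inv-ι (ℕ.pred (4 ℕ.* (2 ℕ.+ k)))))

-- Expanding, (1 - 2c)² (1 + 4c) = 1 - 12c² + 16c³. So the difference times 1 + 4c is 4c² (3 - 4c),
-- which is nonnegative for c ≤ ¼ and at most 12c².
near-square : ∀ {q c} → 0ℚ ≤ c → c ≤ ¼ → q * (1ℚ + 4ℚ * c) ≡ 1ℚ →
              ∣ q - (1ℚ - (c + c)) * (1ℚ - (c + c)) ∣ ≤ 12ℚ * (c * c)
near-square {q} {c} 0≤c c≤¼ q-eq = subst (_≤ 12ℚ * (c * c)) (sym (0≤p⇒∣p∣≡p 0≤x))
  (cancel-≤ 0<1+4c (subst (_≤ 12ℚ * (c * c) * (1ℚ + 4ℚ * c)) (sym x-eq)
    (≤-+ (16ℚ * (c * c * c) + 12ℚ * (c * c) * (4ℚ * c))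
      (+-nonNeg (*-nonNeg (0≤ι 16) (*-nonNeg (*-nonNeg 0≤c 0≤c) 0≤c))
        (*-nonNeg (*-nonNeg (0≤ι 12) (*-nonNeg 0≤c 0≤c)) (*-nonNeg (0≤ι 4) 0≤c)))
      (solve 1 (λ c → con 12ℚ :* (c :* c) :* (con 1ℚ :+ con 4ℚ :* c) :=
        con 4ℚ :* (c :* c) :* (con 3ℚ :- con 4ℚ :* c)
        :+ (con 16ℚ :* (c :* c :* c) :+ con 12ℚ :* (c :* c) :* (con 4ℚ :* c))) refl c))))
  where
  open ≡-Reasoning
  x : ℚ
  x = q - (1ℚ - (c + c)) * (1ℚ - (c + c))
  0<1+4c : 0ℚ < 1ℚ + 4ℚ * c
  0<1+4c = +-mono-<-≤ (positive⁻¹ 1ℚ) (*-nonNeg (0≤ι 4) 0≤c)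
  x-eq : x * (1ℚ + 4ℚ * c) ≡ 4ℚ * (c * c) * (3ℚ - 4ℚ * c)
  x-eq = begin
    x * (1ℚ + 4ℚ * c)
      ≡⟨ solve 2 (λ q c → let v = con 1ℚ :- (c :+ c) ; y = con 1ℚ :+ con 4ℚ :* c in
           (q :- v :* v) :* y := q :* y :- con 1ℚ :+ con 4ℚ :* (c :* c) :* (con 3ℚ :- con 4ℚ :* c)) refl q c ⟩
    q * (1ℚ + 4ℚ * c) - 1ℚ + 4ℚ * (c * c) * (3ℚ - 4ℚ * c)
      ≡⟨ cong (λ y → y - 1ℚ + 4ℚ * (c * c) * (3ℚ - 4ℚ * c)) q-eq ⟩
    0ℚ + 4ℚ * (c * c) * (3ℚ - 4ℚ * c)
      ≡⟨ +-identityˡ (4ℚ * (c * c) * (3ℚ - 4ℚ * c)) ⟩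
    4ℚ * (c * c) * (3ℚ - 4ℚ * c) ∎
  0≤x : 0ℚ ≤ x
  0≤x = cancel-≤ 0<1+4c (subst₂ _≤_ (sym (*-zeroˡ (1ℚ + 4ℚ * c))) (sym x-eq)
    (*-nonNeg (*-nonNeg (0≤ι 4) (*-nonNeg 0≤c 0≤c))
      (≤-trans (nonNegative⁻¹ (3ℚ - 4ℚ * ¼))
        (+-monoʳ-≤ 3ℚ (neg-antimono-≤ (*-monoˡ (0≤ι 4) c≤¼))))))

-- With v = 1 - 2c, `mix w - c` is -½ (w - v). As c ≤ ¼ gives w + v ≥ ½, the factor ½ is absorbed by
-- w + v, and only the difference of squares has to be small.
mix-near : ∀ {w q c δ} → 0ℚ ≤ w → 0ℚ ≤ c → c ≤ ¼ → q * (1ℚ + 4ℚ * c) ≡ 1ℚ →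
           ∣ w * w - q ∣ ≤ δ → ∣ mix w - c ∣ ≤ δ + 12ℚ * (c * c)
mix-near {w} {q} {c} {δ} 0≤w 0≤c c≤¼ q-eq w²-close = begin
  ∣ mix w - c ∣
    ≡⟨ cong ∣_∣ (solve 2 (λ w c → con ½ :* (con 1ℚ :- w) :- c :=
         :- ((w :- (con 1ℚ :- (c :+ c))) :* con ½)) refl w c) ⟩
  ∣ - ((w - v) * ½) ∣
    ≡⟨ trans (∣-p∣≡∣p∣ ((w - v) * ½)) (∣p*q∣≡∣p∣*∣q∣ (w - v) ½) ⟩
  ∣ w - v ∣ * ½
    ≤⟨ *-monoˡ (0≤∣p∣ (w - v)) ½≤w+v ⟩
  ∣ w - v ∣ * (w + v)
    ≡⟨ cong (∣ w - v ∣ *_) (0≤p⇒∣p∣≡p (≤-trans (nonNegative⁻¹ ½) ½≤w+v)) ⟨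
  ∣ w - v ∣ * ∣ w + v ∣
    ≡⟨ ∣p*q∣≡∣p∣*∣q∣ (w - v) (w + v) ⟨
  ∣ (w - v) * (w + v) ∣
    ≡⟨ cong ∣_∣ (solve 3 (λ w v q → (w :- v) :* (w :+ v) := w :* w :- q :+ (q :- v :* v)) refl w v q) ⟩
  ∣ w * w - q + (q - v * v) ∣
    ≤⟨ ∣+∣≤ w²-close (near-square {q} {c} 0≤c c≤¼ q-eq) ⟩
  δ + 12ℚ * (c * c) ∎
  where
  open ≤-Reasoning
  v : ℚ
  v = 1ℚ - (c + c)
  ½≤w+v : ½ ≤ w + v
  ½≤w+v = ≤-+ (w + ((¼ - c) + (¼ - c))) (+-nonNeg 0≤w (+-nonNeg (q-p-nonNeg c≤¼) (q-p-nonNeg c≤¼)))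
    (solve 2 (λ w c → w :+ (con 1ℚ :- (c :+ c)) :=
      con ½ :+ (w :+ ((con ¼ :- c) :+ (con ¼ :- c)))) refl w c)

q-inv : ∀ m → let open Fraction m in q * (1ℚ + 4ℚ * inv m) ≡ 1ℚ
q-inv m = cancel-≡ (0<ι m) (begin
  q * (1ℚ + 4ℚ * c) * s        ≡⟨ solve 3 (λ q c s → q :* (con 1ℚ :+ con 4ℚ :* c) :* s :=
                                     q :* (s :+ con 4ℚ :* (c :* s))) refl q c s ⟩
  q * (s + 4ℚ * (c * s))       ≡⟨ cong (λ x → q * (s + 4ℚ * x)) (inv-ι m) ⟩
  q * (s + ι 4)                ≡⟨ q-ι ⟩
  s                            ≡⟨ *-identityˡ s ⟨
  1ℚ * s                       ∎)
  where
  open ≡-Reasoning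
  open Fraction m
  c = inv m
  s = ι (suc m)

-- With c = 1 / m, the square q = 1 / (1 + 4c) agrees with (1 - 2c)² to first
-- order, so √ q is 1 - 2c up to O(c²).
p⊥-asymptotic : p⊥ ~ (λ m → fromℚ (1 ÷ℕ m))
p⊥-asymptotic ε (e , 0<e , M , e≤ε) =
  let N , inv≤u = inv-small 0<u
  -- The 3 ensures that the chain has at least four elements, so that c = 1 / m ≤ ¼.
  in suc (N ℕ.⊔ 3) , λ where
    (suc m) (ℕ.s≤s le) δ 0<δ →
      let open Fraction m
          c≤u = ≤-trans (inv-antitone (ℕ.m⊔n≤o⇒m≤o N 3 le)) inv≤u
          c≤¼ = inv-antitone (ℕ.m⊔n≤o⇒n≤o N 3 le)
          J , close = w²-close δ 0<δ
      in M ℕ.⊔ J , λ j le′ → bound (inv m) (mix (w j)) (seq ε j) (0≤inv m) c≤u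
           (e≤ε j (ℕ.m⊔n≤o⇒m≤o M J le′))
           (mix-near (0≤w j) (0≤inv m) c≤¼ (q-inv m) (close j (ℕ.m⊔n≤o⇒n≤o M J le′)))
  where
  open ≤-Reasoning
  u : ℚ
  -- Then 12u = ¾ e, so the error 12c² ≤ 12u c stays below e c.
  u = ¼ * ¼ * e
  0<u : 0ℚ < u
  0<u = *-pos (positive⁻¹ (¼ * ¼)) 0<e
  bound : ∀ c p s {δ} → 0ℚ ≤ c → c ≤ u → 0ℚ + e ≤ s → ∣ p - c ∣ ≤ δ + 12ℚ * (c * c) →
          ∣ p - c ∣ ≤ s * ∣ c ∣ + δ
  bound c p s {δ} 0≤c c≤u e≤s le = begin
    ∣ p - c ∣                  ≤⟨ le ⟩
    δ + 12ℚ * (c * c)          ≡⟨ solve 2 (λ d c → d :+ con 12ℚ :* (c :* c) := con 12ℚ :* c :* c :+ d) refl δ c ⟩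
    12ℚ * c * c + δ            ≤⟨ +-monoˡ-≤ δ (*-monoʳ 0≤c (*-monoˡ (0≤ι 12) c≤u)) ⟩
    12ℚ * u * c + δ            ≤⟨ +-monoˡ-≤ δ (*-monoʳ 0≤c (≤-+ {12ℚ * u} (¼ * e) (*-nonNeg (nonNegative⁻¹ ¼) (<⇒≤ 0<e))
                                   (solve 1 (λ e → con 0ℚ :+ e :=
                                     con 12ℚ :* (con (¼ * ¼) :* e) :+ con ¼ :* e) refl e))) ⟩
    (0ℚ + e) * c + δ           ≤⟨ +-monoˡ-≤ δ (*-monoʳ 0≤c e≤s) ⟩
    s * c + δ                  ≡⟨ cong (λ x → s * x + δ) (0≤p⇒∣p∣≡p 0≤c) ⟨
    s * ∣ c ∣ + δ              ∎

proposition8 : ∃ λ (p⊥ : ℕ → ℝ) →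
    (∀ m → 2 ℕ.≤ m →
    ((λ n → fromℚ (g m n 0 ÷ℕ gTotal m n)) ⟶ p⊥ m) ×
    (p⊥ m ≃ℝ fromℚ ½ *ℝ (1ℝ -ℝ √ℝ (fromℚ (m ÷ℕ (m ℕ.+ 4)))))) ×
    (p⊥ ~ (λ m → fromℚ (1 ÷ℕ m)))
proposition8 = p⊥
  , (λ { (suc (suc k)) (ℕ.s≤s (ℕ.s≤s ℕ.z≤n)) → p⊥-limit k , ≃ℝ-refl (p⊥ (2 ℕ.+ k)) })
  , p⊥-asymptotic
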